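{- There exists a Super Harmonic algorithm $\mathcal A$ (where more than one red item per bin is allowed) whose asymptotic competitive ratio satisfies $\mathcal R^\infty_{\mathcal A}\le 1.5884$.
   Context: Online bin packing: a finite sequence $\sigma$ of items with sizes in $(0,1]$ arrives one by one; each must be irrevocably assigned to a bin of capacity $1$ before the next one becomes available. $\mathcal A(\sigma)$ is the number of bins used by algorithm $\mathcal A$ on $\sigma$, $\mathrm{opt}(\sigma)$ the offline optimum, and $$\mathcal R^{\infty}_{\mathcal A}=\limsup_{n\to\infty}\sup_\sigma\{\mathcal A(\sigma)/\mathrm{opt}(\sigma) : \mathrm{opt}(\sigma)=n\}.$$ Super Harmonic algorithms. Parameters: an integer $N$; thresholds $1=t_1\ge t_2\ge\dots\ge t_N>0$; a finite list of spaces $\mathrm{redspace}_1\le\dots\le\mathrm{redspace}_K$ in $(0,1)$; fractions $\mathrm{red}_j\in[0,1]$ for each type $j$; functions $\mathrm{leaves},\mathrm{needs}:\{1,\dots,N\}\to\{0,\dots,K\}$. An item has type $j<N$ if its size lies in $(t_{j+1},t_j]$ and type $N$ if its size lies in $(0,t_N]$. Put $\mathrm{bluefit}_j=\lfloor 1/t_j\rfloor$. It is required that $\mathrm{needs}(j)=0$ if and only if $\mathrm{red}_j=0$; if $\mathrm{red}_j>0$ then $\mathrm{redfit}_j=\lfloor \mathrm{redspace}_{\mathrm{needs}(j)}/t_j\rfloor\ge1$; if $\mathrm{leaves}(j)>0$ then $\mathrm{redspace}_{\mathrm{leaves}(j)}\le 1-\mathrm{bluefit}_j t_j$ ($\mathrm{leaves}(j)=0$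 means that no space is left for red items). Items of type $N$ are packed by Next Fit into bins used only for type $N$. For each type $i<N$ maintain counters $n^i$ (items of type $i$) and $n^i_{\mathrm{red}}$ (red items of type $i$), initially $0$. When an item of type $i<N$ arrives, set $n^i\gets n^i+1$. If $n^i_{\mathrm{red}}<\lfloor \mathrm{red}_i n^i\rfloor$, the item is colored $c=$ red and $n^i_{\mathrm{red}}\gets n^i_{\mathrm{red}}+1$; otherwise it is colored $c=$ blue. It is then placed in the first available kind of bin among: (1) a $c$-open bin that contains items of type $i$ and color $c$; (2) an unmixed bin compatible with it (which thereby becomes mixed); (3) a new bin, which is pure blue if $c$ is blue and $\mathrm{leaves}(i)=0$, and unmixed otherwise. A bin holds at most $\mathrm{bluefit}_i$ blue items if its blue items have type $i$, and at most $\mathrm{redfit}_j$ red items if its red items have type $j$; a bin is blue-open (red-open) if it contains at least one blue (red) item but fewer than this maximum. Pure blue bins only ever contain blue items of one type; an unmixed bin is a bin that is not pure blue and contains items of only one type and color; a mixed bin contains blue items of one type and red items of another. An unmixed bin with blue items of type $j$ is compatible with a red item of type $i$ if $\mathrm{needs}(i)\le\mathrm{leaves}(j)$; an unmixed bin with red items of type $j$ is compatible with a blue item of type $i$ if $\mathrm{needs}(j)\le\mathrm{leaves}(i)$. -}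

module Defs where

open import Data.Fin.Base as Fin using (Fin; zero; suc; fromℕ)
open import Data.Integer.Base using (+_)
open import Data.List.Base using (List; []; _∷_; length; concat; map; foldr)
open import Data.List.Relation.Binary.Permutation.Propositional using (_↭_)
open import Data.List.Relation.Unary.All using (All)
open import Data.Nat.Base as ℕ using (ℕ; zero; suc; NonZero; _⊔_)
import Data.Nat.Properties as ℕ
open import Data.Product.Base using (Σ-syntax; ∃; ∃-syntax; _×_; _,_)
open import Data.Rational.Base as ℚ using (ℚ; 0ℚ; 1ℚ; ½; ∣_∣; _/_)
import Data.Rational.Properties as ℚ
open import Data.Rational.Solver using (module +-*-Solver)
open import Data.Vec.Functional using (Vector; updateAt; replicate)
open import Function.Bundles using (_⇔_)
open import Relation.Binary.PropositionalEquality
  using (_≡_; _≢_; refl; sym; trans; cong; subst)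
open import Relation.Nullary.Negation using (¬_)

------------------------------------------------------------------------
-- Cauchy real numbers, with pointwise operations

IsCauchy : (ℕ → ℚ) → Set
IsCauchy x = ∀ ε → 0ℚ ℚ.< ε →
  ∃[ N ] (∀ m n → N ℕ.≤ m → N ℕ.≤ n → ∣ x m ℚ.- x n ∣ ℚ.≤ ε)

record ℝ : Set where
  constructor mkℝ
  field
    approx : ℕ → ℚ
    cauchy : IsCauchy approx

open ℝ public

fromℚ : ℚ → ℝ
approx (fromℚ q) _ = q
cauchy (fromℚ q) ε 0<ε = 0 , λ _ _ _ _ →
  subst (λ d → ∣ d ∣ ℚ.≤ ε) (sym (ℚ.+-inverseʳ q)) (ℚ.<⇒≤ 0<ε)

0ℝ 1ℝ : ℝ
0ℝ = fromℚ 0ℚ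
1ℝ = fromℚ 1ℚ

infixl 6 _+_ _-_
infixr 7 _·_
infix  8 -_
infix  4 _≤_ _<_ _≃_ ⌊_÷_⌋≡_ ⌊_⌋≡_

_+_ : ℝ → ℝ → ℝ
approx (x + y) n = approx x n ℚ.+ approx y n
cauchy (x + y) ε 0<ε
  with cauchy x (½ ℚ.* ε) 0<ε/2 | cauchy y (½ ℚ.* ε) 0<ε/2
  where
  0<ε/2 : 0ℚ ℚ.< ½ ℚ.* ε
  0<ε/2 = subst (ℚ._< ½ ℚ.* ε) (ℚ.*-zeroʳ ½) (ℚ.*-monoʳ-<-pos ½ 0<ε)
... | M , hx | N , hy = M ⊔ N , λ m n M⊔N≤m M⊔N≤n →
  let a = approx x m; b = approx x n; c = approx y m; d = approx y n in
  begin
    ∣ (a ℚ.+ c) ℚ.- (b ℚ.+ d) ∣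
      ≡⟨ cong ∣_∣ (interchange a b c d) ⟩
    ∣ (a ℚ.- b) ℚ.+ (c ℚ.- d) ∣
      ≤⟨ ℚ.∣p+q∣≤∣p∣+∣q∣ (a ℚ.- b) (c ℚ.- d) ⟩
    ∣ a ℚ.- b ∣ ℚ.+ ∣ c ℚ.- d ∣
      ≤⟨ ℚ.+-mono-≤
           (hx m n (ℕ.m⊔n≤o⇒m≤o M N M⊔N≤m) (ℕ.m⊔n≤o⇒m≤o M N M⊔N≤n))
           (hy m n (ℕ.m⊔n≤o⇒n≤o M N M⊔N≤m) (ℕ.m⊔n≤o⇒n≤o M N M⊔N≤n)) ⟩
    ½ ℚ.* ε ℚ.+ ½ ℚ.* ε
      ≡⟨ ℚ.*-distribʳ-+ ε ½ ½ ⟨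
    1ℚ ℚ.* ε
      ≡⟨ ℚ.*-identityˡ ε ⟩
    ε ∎
  where
  open ℚ.≤-Reasoning
  interchange : ∀ a b c d →
    (a ℚ.+ c) ℚ.- (b ℚ.+ d) ≡ (a ℚ.- b) ℚ.+ (c ℚ.- d)
  interchange = solve 4 (λ a b c d →
    (a :+ c) :- (b :+ d) := (a :- b) :+ (c :- d)) refl
    where open +-*-Solver

-_ : ℝ → ℝ
approx (- x) n = ℚ.- approx x n
cauchy (- x) ε 0<ε with cauchy x ε 0<ε
... | N , hx = N , λ m n N≤m N≤n →
  subst (ℚ._≤ ε) (flip (approx x m) (approx x n)) (hx m n N≤m N≤n)
  where
  flip : ∀ a b → ∣ a ℚ.- b ∣ ≡ ∣ ℚ.- a ℚ.- ℚ.- b ∣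
  flip a b = trans (sym (ℚ.∣-p∣≡∣p∣ (a ℚ.- b)))
                   (cong ∣_∣ (ℚ.neg-distrib-+ a (ℚ.- b)))

_-_ : ℝ → ℝ → ℝ
x - y = x + (- y)

_·_ : ℕ → ℝ → ℝ
zero  · x = 0ℝ
suc n · x = x + n · x

sum : List ℝ → ℝ
sum = foldr _+_ 0ℝ

_≤_ : ℝ → ℝ → Set
x ≤ y = ∀ ε → 0ℚ ℚ.< ε →
  ∃[ N ] (∀ n → N ℕ.≤ n → approx x n ℚ.≤ approx y n ℚ.+ ε)

_<_ : ℝ → ℝ → Set
x < y = ∃[ ε ] 0ℚ ℚ.< ε ×
  ∃[ N ] (∀ n → N ℕ.≤ n → approx x n ℚ.+ ε ℚ.≤ approx y n)

_≃_ : ℝ → ℝ → Set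
x ≃ y = x ≤ y × y ≤ x

-- Since the floor of a real is not computable, floors are relations.
-- The first is meant for positive divisors y, where k ≤ x/y < k+1
-- amounts to k·y ≤ x < (k+1)·y.

⌊_÷_⌋≡_ : ℝ → ℝ → ℕ → Set
⌊ x ÷ y ⌋≡ k = k · y ≤ x × x < suc k · y

⌊_⌋≡_ : ℝ → ℕ → Set
⌊ x ⌋≡ k = ⌊ x ÷ 1ℝ ⌋≡ k

------------------------------------------------------------------------
-- Bin packing

record Item : Set where
  field
    size     : ℝ
    positive : 0ℝ < size
    size≤1   : size ≤ 1ℝ

open Item public

Packable : List Item → ℕ → Set
Packable σ n = Σ[ bins ∈ List (List Item) ]
  length bins ≡ n × concat bins ↭ σ × All (λ bin → sum (map size bin) ≤ 1ℝ) bins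

IsOpt : List Item → ℕ → Set
IsOpt σ n = Packable σ n × (∀ m → Packable σ m → n ℕ.≤ m)

-- An algorithm enters only through its cost relation: 𝒜 σ k says that
-- the algorithm may use k bins on input σ.

Cost : Set₁
Cost = List Item → ℕ → Set

-- The set { 𝒜(σ) / opt(σ) : opt(σ) = n }.

data Ratio (𝒜 : Cost) (n : ℕ) : ℚ → Set where
  ratio : ∀ {σ k} .{{_ : NonZero n}} →
          IsOpt σ n → 𝒜 σ k → Ratio 𝒜 n (+ k / n)

-- limsup (n → ∞) sup (S n) ≤ c.  The limsup is the infimum over m of
-- the suprema of ⋃ { S n : n ≥ m }, so it is at most c iff every q > c
-- is an upper bound of one of these unions.

LimsupSup≤ : (ℕ → ℚ → Set) → ℚ → Set
LimsupSup≤ S c = ∀ q → c ℚ.< q →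
  ∃[ m ] (∀ n → m ℕ.≤ n → ∀ r → S n r → r ℚ.≤ q)

AsymptoticRatio≤ : Cost → ℚ → Set
AsymptoticRatio≤ 𝒜 c = LimsupSup≤ (Ratio 𝒜) c

------------------------------------------------------------------------
-- Super Harmonic algorithms

-- The lower end of the size interval of each type: the next threshold,
-- or 0 for the last type.

lowerEnd : ∀ {M} → Vector ℝ (suc M) → Vector ℝ (suc M)
lowerEnd {zero}  t zero    = 0ℝ
lowerEnd {suc M} t zero    = t (suc zero)
lowerEnd {suc M} t (suc j) = lowerEnd (λ i → t (suc i)) j

-- The types 1, …, N are Fin (suc M) with N = M + 1, so type N is
-- fromℕ M.  The values of leaves and needs lie in {0, …, K} = Fin (suc K),
-- and redspace k with k : Fin K is the space whose number is suc k.

record SuperHarmonic : Set where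
  field
    M K      : ℕ
    t        : Vector ℝ (suc M)
    redspace : Vector ℝ K
    red      : Vector ℝ (suc M)
    leaves   : Fin (suc M) → Fin (suc K)
    needs    : Fin (suc M) → Fin (suc K)
    bluefit  : Fin (suc M) → ℕ
    redfit   : Fin (suc M) → ℕ    -- irrelevant where red is 0

    t-first      : t zero ≃ 1ℝ
    t-decreasing : ∀ i j → i Fin.≤ j → t j ≤ t i
    t-positive   : 0ℝ < t (fromℕ M)

    redspace-increasing : ∀ k l → k Fin.≤ l → redspace k ≤ redspace l
    redspace-positive   : ∀ k → 0ℝ < redspace k
    redspace-<1         : ∀ k → redspace k < 1ℝ

    red-nonNegative : ∀ j → 0ℝ ≤ red j
    red-≤1          : ∀ j → red j ≤ 1ℝ

    bluefit-floor : ∀ j → ⌊ 1ℝ ÷ t j ⌋≡ bluefit j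
    needs-zero    : ∀ j → needs j ≡ zero ⇔ red j ≃ 0ℝ
    redfit-floor  : ∀ j k → 0ℝ < red j → needs j ≡ suc k →
                    ⌊ redspace k ÷ t j ⌋≡ redfit j
    redfit-≥1     : ∀ j → 0ℝ < red j → 1 ℕ.≤ redfit j
    leaves-fits   : ∀ j k → leaves j ≡ suc k →
                    redspace k ≤ 1ℝ - bluefit j · t j

data Color : Set where
  blue red : Color

module Execution (P : SuperHarmonic) where
  open SuperHarmonic P renaming (red to redFraction)

  Type : Set
  Type = Fin (suc M)

  typeN : Type
  typeN = fromℕ M

  HasType : Item → Type → Set
  HasType x j = lowerEnd t j < size x × size x ≤ t j

  maxFit : Color → Type → ℕ
  maxFit blue = bluefit
  maxFit red  = redfit

  -- The bins that do not contain type N, with the number of items they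
  -- hold; in mixed i b j r the b blue items have type i and the r red
  -- items have type j.

  data Bin : Set where
    pureBlue : Type → ℕ → Bin
    unmixed  : Color → Type → ℕ → Bin
    mixed    : Type → ℕ → Type → ℕ → Bin

  -- Adding an item to a c-open bin with items of its type and color c.
  -- No bin is created with an empty part, so c-open amounts to the
  -- upper bound on the number of items.

  data AddToOpen : Color → Type → Bin → Bin → Set where
    pureBlue  : ∀ {i b} → b ℕ.< maxFit blue i →
                AddToOpen blue i (pureBlue i b) (pureBlue i (suc b))
    unmixed   : ∀ {c i n} → n ℕ.< maxFit c i →
                AddToOpen c i (unmixed c i n) (unmixed c i (suc n))
    mixedBlue : ∀ {i b j r} → b ℕ.< maxFit blue i →
                AddToOpen blue i (mixed i b j r) (mixed i (suc b) j r)
    mixedRed  : ∀ {i b j r} → r ℕ.< maxFit red j →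
                AddToOpen red j (mixed i b j r) (mixed i b j (suc r))

  data AddToCompatible : Color → Type → Bin → Bin → Set where
    redToBlue : ∀ {i j b} → needs i Fin.≤ leaves j →
                AddToCompatible red i (unmixed blue j b) (mixed j b i 1)
    blueToRed : ∀ {i j r} → needs j Fin.≤ leaves i →
                AddToCompatible blue i (unmixed red j r) (mixed i 1 j r)

  newBin : Color → Type → Bin
  newBin red  i = unmixed red i 1
  newBin blue i with leaves i
  ... | zero  = pureBlue i 1
  ... | suc _ = unmixed blue i 1

  data InSomeBin (R : Bin → Bin → Set) : List Bin → List Bin → Set where
    here  : ∀ {b b′ bs} → R b b′ → InSomeBin R (b ∷ bs) (b′ ∷ bs)
    there : ∀ {b bs bs′} → InSomeBin R bs bs′ →
            InSomeBin R (b ∷ bs) (b ∷ bs′)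

  -- Ties between several suitable bins are broken arbitrarily.

  data Place (c : Color) (i : Type) (bs : List Bin) : List Bin → Set where
    open-bin       : ∀ {bs′} → InSomeBin (AddToOpen c i) bs bs′ →
                     Place c i bs bs′
    compatible-bin : ∀ {bs′} → ¬ ∃ (InSomeBin (AddToOpen c i) bs) →
                     InSomeBin (AddToCompatible c i) bs bs′ →
                     Place c i bs bs′
    new-bin        : ¬ ∃ (InSomeBin (AddToOpen c i) bs) →
                     ¬ ∃ (InSomeBin (AddToCompatible c i) bs) →
                     Place c i bs (newBin c i ∷ bs)

  -- ColorOf i n nʳ c: with n items of type i (the new one included) and
  -- nʳ earlier red ones, the new item gets color c.

  data ColorOf (i : Type) (n nʳ : ℕ) : Color → Set where
    red  : ∀ {f} → ⌊ n · redFraction i ⌋≡ f → nʳ ℕ.< f → ColorOf i n nʳ red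
    blue : ∀ {f} → ⌊ n · redFraction i ⌋≡ f → f ℕ.≤ nʳ → ColorOf i n nʳ blue

  countRed : Color → Type → Vector ℕ (suc M) → Vector ℕ (suc M)
  countRed red  i nʳ = updateAt nʳ i suc
  countRed blue i nʳ = nʳ

  -- Next Fit on the list of bin levels, the current bin being the head.

  data NextFit (s : ℝ) : List ℝ → List ℝ → Set where
    first : NextFit s [] (s ∷ [])
    fits  : ∀ {l ls} → l + s ≤ 1ℝ → NextFit s (l ∷ ls) (l + s ∷ ls)
    opens : ∀ {l ls} → 1ℝ < l + s → NextFit s (l ∷ ls) (s ∷ l ∷ ls)

  record State : Set where
    constructor state
    field
      count    : Vector ℕ (suc M)
      redCount : Vector ℕ (suc M)
      bins     : List Bin
      binsN    : List ℝ

  open State public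

  initial : State
  initial = state (replicate (suc M) 0) (replicate (suc M) 0) [] []

  data Step (x : Item) : State → State → Set where
    stepN : ∀ {n nʳ bs ls ls′} →
            HasType x typeN → NextFit (size x) ls ls′ →
            Step x (state n nʳ bs ls) (state n nʳ bs ls′)
    step  : ∀ {n nʳ bs ls bs′ i c} →
            HasType x i → i ≢ typeN →
            ColorOf i (suc (n i)) (nʳ i) c → Place c i bs bs′ →
            Step x (state n nʳ bs ls)
                   (state (updateAt n i suc) (countRed c i nʳ) bs′ ls)

  data Run : State → List Item → State → Set where
    []  : ∀ {s} → Run s [] s
    _∷_ : ∀ {s s′ s″ x σ} → Step x s s′ → Run s′ σ s″ → Run s (x ∷ σ) s″

  cost : Cost
  cost σ k = Σ[ s ∈ State ]
    Run initial σ s × k ≡ length (bins s) ℕ.+ length (binsN s)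

open Execution public using (cost)

module Submission where

-- When a run of the algorithm ends, let k be the least value of needs
-- among the unmixed red bins.  No unmixed blue bin is compatible with
-- them, so blue groups with leaves ≥ k and red groups with needs < k all
-- sit in mixed bins.  Counting each mixed bin by its red group or by its
-- blue group gives two upper bounds on the number of bins, and hence, for
-- every convex combination of them, a weight of each item such that the
-- cost is at most the total weight plus a constant: all but one group per
-- color and type is full, and the number of red items of a type is the
-- prescribed share up to rounding.  It remains to see that, for every k,
-- the items of an optimal bin weigh at most 1.5884.  An item of type j is
-- larger than the next threshold, so after subtracting the weight density
-- of the type N items this is an integer knapsack problem with one kind of
-- object per type, which a verified branch and bound solves by evaluation.

-- The cost is at most the minimum of the two counts, but a minimum of sums cannot be estimated bin
-- by bin: an optimal packing may combine bins that are expensive only for one count with bins that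
-- are expensive only for the other. A convex combination is linear in the items, and by minimax a
-- well chosen one loses nothing; hence one mixing coefficient for each k. Type N items act as sand:
-- they can fill whatever the other items leave of a bin, at a fixed weight A per unit of size.
-- Charging A for every unit of size, sand or not, bounds a bin by A plus the excess of its items
-- over that charge, and only the excess is left for the search. Sizes are Cauchy reals, whose order
-- is undecidable. So the type of an item is known only from the step that packed it, and real
-- estimates are made between multiples of 1/D, where they become inequalities of natural numbers.

open import Defs as ℝ hiding (_+_; _-_; _·_; -_; _≤_; _<_; _≃_; sum)
open import Algebra.Bundles using (module CommutativeMonoid)
import Algebra.Properties.CommutativeMonoid.Sum
open import Data.Bool.Base using (Bool; true; false; _∧_; _∨_; if_then_else_; T)
open import Data.Bool.Properties using (T-∧; T-∨)
open import Data.Fin.Base as Fin using (Fin; zero; suc; toℕ; fromℕ)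
import Data.Fin.Properties as Fin
open import Data.Integer.Base as ℤ using (+_; -[1+_])
import Data.Integer.Properties as ℤ
open import Data.List.Base using (List; []; _∷_; _++_; length; map; concat; allFin)
open import Data.List.Membership.Propositional using (_∈_)
open import Data.List.Membership.Propositional.Properties using (∈-map⁺; ∈-allFin)
open import Data.List.Relation.Binary.Permutation.Propositional using (_↭_; refl; prep; swap; ↭-sym)
open import Data.List.Relation.Unary.All as All using (All; []; _∷_)
open import Data.List.Relation.Unary.Any using (here; there)
open import Data.Nat.Base as ℕ using
  ( ℕ; zero; suc; pred; _+_; _*_; _∸_; _⊓_; _⊔_; _%_; _≤_; _<_; z≤n; s≤s; _≡ᵇ_; _≤ᵇ_; _<ᵇ_
  ; NonZero; >-nonZero; >-nonZero⁻¹)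
open import Data.Nat.DivMod using (m/n*n≤m; m≡m%n+[m/n]*n; m%n<n)
open import Data.Nat.ListAction using (sum)
open import Data.Nat.Properties
open import Data.Nat.Tactic.RingSolver using (solve-∀)
open import Data.Product.Base using (Σ-syntax; ∃; ∃-syntax; _×_; _,_; proj₁; proj₂)
open import Data.Rational.Base as ℚ using (ℚ; mkℚ; 0ℚ; 1ℚ; ½; _/_)
import Data.Rational.Properties as ℚ
import Data.Rational.Unnormalised.Base as ℚᵘ
import Data.Rational.Unnormalised.Properties as ℚᵘ
open import Data.Sum.Base using (_⊎_; inj₁; inj₂)
open import Data.Unit.Base using (⊤)
open import Data.Vec.Base using (Vec; []; _∷_; lookup)
open import Data.Vec.Functional using (Vector; updateAt; tail)
open import Data.Vec.Functional.Properties using (updateAt-updates; updateAt-minimal)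
open import Function.Base using (_∘_; const)
open import Function.Bundles using (Equivalence; mk⇔)
open import Relation.Binary.PropositionalEquality
open import Relation.Nullary.Decidable using (Dec; yes; no; does; _→-dec_; toWitness)
open import Relation.Nullary.Negation using (¬_; contradiction)

open import Algebra.Properties.CommutativeSemigroup
  (CommutativeMonoid.commutativeSemigroup ℚ.+-0-commutativeMonoid) using (interchange)
open import Algebra.Properties.CommutativeSemigroup +-commutativeSemigroup
  using (x∙yz≈y∙xz) renaming (interchange to +-interchange)
open import Algebra.Properties.Group ℚ.+-0-group using (//-rightDividesˡ; //-rightDividesʳ)
open Algebra.Properties.CommutativeMonoid.Sum +-0-commutativeMonoid
  using () renaming (sum to Σ; sum-cong-≗ to Σ-cong; ∑-distrib-+ to Σ-+)

-- Ordered-group structure of ℝ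

-- The order on ℝ only involves the approximations.  As records the
-- relations are injective, which _≤_ and _<_ are not.

infixl 6 _⊞_
infixr 7 _⊡_
infix  4 _≼_ _≺_

Seq : Set
Seq = ℕ → ℚ

record _≼_ (x y : Seq) : Set where
  constructor ⟨_⟩
  field
    ≼⇒≤ : ∀ ε → 0ℚ ℚ.< ε → ∃[ N ] (∀ n → N ≤ n → x n ℚ.≤ y n ℚ.+ ε)

record _≺_ (x y : Seq) : Set where
  constructor ⟨_⟩
  field
    ≺⇒< : ∃[ ε ] 0ℚ ℚ.< ε × ∃[ N ] (∀ n → N ≤ n → x n ℚ.+ ε ℚ.≤ y n)

open _≼_ public
open _≺_ public

_⊞_ : Seq → Seq → Seq
(x ⊞ y) n = x n ℚ.+ y n

_⊡_ : ℕ → Seq → Seq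
(zero  ⊡ x) n = 0ℚ
(suc m ⊡ x) n = x n ℚ.+ (m ⊡ x) n

0ˢ : Seq
0ˢ = const 0ℚ

≼-pointwise : ∀ {x y} → (∀ n → x n ℚ.≤ y n) → x ≼ y
≼-pointwise {x} {y} x≤y = ⟨ (λ ε 0<ε → 0 , λ n _ →
  ℚ.≤-trans (x≤y n) (subst (ℚ._≤ y n ℚ.+ ε) (ℚ.+-identityʳ (y n))
    (ℚ.+-monoʳ-≤ (y n) (ℚ.<⇒≤ 0<ε)))) ⟩

≼-refl : ∀ {x} → x ≼ x
≼-refl = ≼-pointwise λ _ → ℚ.≤-refl

≼-reflexive : ∀ {x y} → (∀ n → x n ≡ y n) → x ≼ y
≼-reflexive x≡y = ≼-pointwise (ℚ.≤-reflexive ∘ x≡y)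

0<½*_ : ∀ {ε} → 0ℚ ℚ.< ε → 0ℚ ℚ.< ½ ℚ.* ε
0<½*_ {ε} 0<ε = subst (ℚ._< ½ ℚ.* ε) (ℚ.*-zeroʳ ½) (ℚ.*-monoʳ-<-pos ½ 0<ε)

½+½ : ∀ ε → ½ ℚ.* ε ℚ.+ ½ ℚ.* ε ≡ ε
½+½ ε = trans (sym (ℚ.*-distribʳ-+ ε ½ ½)) (ℚ.*-identityˡ ε)

ℚ-+-cancelʳ-≤ : ∀ r {p q} → p ℚ.+ r ℚ.≤ q ℚ.+ r → p ℚ.≤ q
ℚ-+-cancelʳ-≤ r {p} {q} le =
  subst₂ ℚ._≤_ (//-rightDividesʳ r p) (//-rightDividesʳ r q) (ℚ.+-monoˡ-≤ (ℚ.- r) le)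

≼-trans : ∀ {x y z} → x ≼ y → y ≼ z → x ≼ z
≼-trans {x} {y} {z} ⟨ x≤y ⟩ ⟨ y≤z ⟩ = ⟨ (λ ε 0<ε →
  let M , p = x≤y _ (0<½* 0<ε); N , q = y≤z _ (0<½* 0<ε) in
  M ⊔ N , λ n le → begin
    x n                             ≤⟨ p n (m⊔n≤o⇒m≤o M N le) ⟩
    y n ℚ.+ ½ ℚ.* ε                 ≤⟨ ℚ.+-monoˡ-≤ (½ ℚ.* ε) (q n (m⊔n≤o⇒n≤o M N le)) ⟩
    (z n ℚ.+ ½ ℚ.* ε) ℚ.+ ½ ℚ.* ε   ≡⟨ ℚ.+-assoc (z n) _ _ ⟩
    z n ℚ.+ (½ ℚ.* ε ℚ.+ ½ ℚ.* ε)   ≡⟨ cong (z n ℚ.+_) (½+½ ε) ⟩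
    z n ℚ.+ ε                       ∎) ⟩
  where open ℚ.≤-Reasoning

⊞-mono-≼ : ∀ {x y u v} → x ≼ y → u ≼ v → x ⊞ u ≼ y ⊞ v
⊞-mono-≼ {x} {y} {u} {v} ⟨ x≤y ⟩ ⟨ u≤v ⟩ = ⟨ (λ ε 0<ε →
  let M , p = x≤y _ (0<½* 0<ε); N , q = u≤v _ (0<½* 0<ε) in
  M ⊔ N , λ n le → begin
    x n ℚ.+ u n
      ≤⟨ ℚ.+-mono-≤ (p n (m⊔n≤o⇒m≤o M N le)) (q n (m⊔n≤o⇒n≤o M N le)) ⟩
    (y n ℚ.+ ½ ℚ.* ε) ℚ.+ (v n ℚ.+ ½ ℚ.* ε)
      ≡⟨ interchange (y n) _ _ _ ⟩
    (y n ℚ.+ v n) ℚ.+ (½ ℚ.* ε ℚ.+ ½ ℚ.* ε)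
      ≡⟨ cong ((y n ℚ.+ v n) ℚ.+_) (½+½ ε) ⟩
    (y n ℚ.+ v n) ℚ.+ ε
      ∎) ⟩
  where open ℚ.≤-Reasoning

-- `x ≼ y` holds only up to an arbitrary error, so half of the gap of `y ≺ z` is spent on it and the
-- other half is the new gap.
≼-≺-trans : ∀ {x y z} → x ≼ y → y ≺ z → x ≺ z
≼-≺-trans {x} {y} {z} ⟨ x≤y ⟩ ⟨ ε , 0<ε , N , q ⟩ =
  let M , p = x≤y _ (0<½* 0<ε) in
  ⟨ ½ ℚ.* ε , 0<½* 0<ε , M ⊔ N , (λ n le → begin
    x n ℚ.+ ½ ℚ.* ε                 ≤⟨ ℚ.+-monoˡ-≤ _ (p n (m⊔n≤o⇒m≤o M N le)) ⟩
    (y n ℚ.+ ½ ℚ.* ε) ℚ.+ ½ ℚ.* ε   ≡⟨ ℚ.+-assoc (y n) _ _ ⟩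
    y n ℚ.+ (½ ℚ.* ε ℚ.+ ½ ℚ.* ε)   ≡⟨ cong (y n ℚ.+_) (½+½ ε) ⟩
    y n ℚ.+ ε                       ≤⟨ q n (m⊔n≤o⇒n≤o M N le) ⟩
    z n                             ∎) ⟩
  where open ℚ.≤-Reasoning

⊞-mono-≺-≼ : ∀ {x y u v} → x ≺ y → u ≼ v → x ⊞ u ≺ y ⊞ v
⊞-mono-≺-≼ {x} {y} {u} {v} ⟨ ε , 0<ε , N , q ⟩ ⟨ u≤v ⟩ =
  let M , p = u≤v _ (0<½* 0<ε) in
  ⟨ ½ ℚ.* ε , 0<½* 0<ε , M ⊔ N , (λ n le →
    let a = x n; b = y n; c = u n; d = v n in
    ℚ-+-cancelʳ-≤ (½ ℚ.* ε) (begin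
      ((a ℚ.+ c) ℚ.+ ½ ℚ.* ε) ℚ.+ ½ ℚ.* ε   ≡⟨ ℚ.+-assoc (a ℚ.+ c) _ _ ⟩
      (a ℚ.+ c) ℚ.+ (½ ℚ.* ε ℚ.+ ½ ℚ.* ε)   ≡⟨ cong ((a ℚ.+ c) ℚ.+_) (½+½ ε) ⟩
      (a ℚ.+ c) ℚ.+ ε                       ≡⟨ ℚ.+-assoc a c ε ⟩
      a ℚ.+ (c ℚ.+ ε)                       ≡⟨ cong (a ℚ.+_) (ℚ.+-comm c ε) ⟩
      a ℚ.+ (ε ℚ.+ c)                       ≡⟨ ℚ.+-assoc a ε c ⟨
      (a ℚ.+ ε) ℚ.+ c
        ≤⟨ ℚ.+-mono-≤ (q n (m⊔n≤o⇒n≤o M N le)) (p n (m⊔n≤o⇒m≤o M N le)) ⟩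
      b ℚ.+ (d ℚ.+ ½ ℚ.* ε)                 ≡⟨ ℚ.+-assoc b d _ ⟨
      (b ℚ.+ d) ℚ.+ ½ ℚ.* ε                 ∎)) ⟩
  where open ℚ.≤-Reasoning

⊞-identityʳ-≼ : ∀ {x} → x ≼ x ⊞ 0ˢ
⊞-identityʳ-≼ {x} = ≼-reflexive λ n → sym (ℚ.+-identityʳ (x n))

⊞-identityʳ-≽ : ∀ {x} → x ⊞ 0ˢ ≼ x
⊞-identityʳ-≽ {x} = ≼-reflexive λ n → ℚ.+-identityʳ (x n)

≺-≼-trans : ∀ {x y z} → x ≺ y → y ≼ z → x ≺ z
≺-≼-trans {x} {y} {z} ⟨ ε , 0<ε , N , q ⟩ ⟨ y≤z ⟩ =
  let M , p = y≤z _ (0<½* 0<ε) in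
  ⟨ ½ ℚ.* ε , 0<½* 0<ε , M ⊔ N , (λ n le →
    ℚ-+-cancelʳ-≤ (½ ℚ.* ε) (begin
      (x n ℚ.+ ½ ℚ.* ε) ℚ.+ ½ ℚ.* ε   ≡⟨ ℚ.+-assoc (x n) _ _ ⟩
      x n ℚ.+ (½ ℚ.* ε ℚ.+ ½ ℚ.* ε)   ≡⟨ cong (x n ℚ.+_) (½+½ ε) ⟩
      x n ℚ.+ ε                       ≤⟨ q n (m⊔n≤o⇒n≤o M N le) ⟩
      y n                             ≤⟨ p n (m⊔n≤o⇒m≤o M N le) ⟩
      z n ℚ.+ ½ ℚ.* ε                 ∎)) ⟩
  where open ℚ.≤-Reasoning

≺⇒≼ : ∀ {x y} → x ≺ y → x ≼ y
≺⇒≼ {x} {y} ⟨ δ , 0<δ , N , q ⟩ = ⟨ (λ ε 0<ε → N , λ n le → begin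
    x n           ≡⟨ ℚ.+-identityʳ (x n) ⟨
    x n ℚ.+ 0ℚ    ≤⟨ ℚ.+-monoʳ-≤ (x n) (ℚ.<⇒≤ 0<δ) ⟩
    x n ℚ.+ δ     ≤⟨ q n le ⟩
    y n           ≡⟨ ℚ.+-identityʳ (y n) ⟨
    y n ℚ.+ 0ℚ    ≤⟨ ℚ.+-monoʳ-≤ (y n) (ℚ.<⇒≤ 0<ε) ⟩
    y n ℚ.+ ε     ∎) ⟩
  where open ℚ.≤-Reasoning

⊞-cancelʳ-≼ : ∀ z {x y} → x ⊞ z ≼ y ⊞ z → x ≼ y
⊞-cancelʳ-≼ z {x} {y} ⟨ le ⟩ = ⟨ (λ ε 0<ε → let N , p = le ε 0<ε in N , λ n N≤n →
  ℚ-+-cancelʳ-≤ (z n) (begin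
    x n ℚ.+ z n             ≤⟨ p n N≤n ⟩
    (y n ℚ.+ z n) ℚ.+ ε     ≡⟨ ℚ.+-assoc (y n) (z n) ε ⟩
    y n ℚ.+ (z n ℚ.+ ε)     ≡⟨ cong (y n ℚ.+_) (ℚ.+-comm (z n) ε) ⟩
    y n ℚ.+ (ε ℚ.+ z n)     ≡⟨ ℚ.+-assoc (y n) ε (z n) ⟨
    (y n ℚ.+ ε) ℚ.+ z n     ∎)) ⟩
  where open ℚ.≤-Reasoning

⊞-assoc-≼ : ∀ x y z → (x ⊞ y) ⊞ z ≼ x ⊞ (y ⊞ z)
⊞-assoc-≼ x y z = ≼-reflexive λ n → ℚ.+-assoc (x n) (y n) (z n)

⊞-assoc-≽ : ∀ x y z → x ⊞ (y ⊞ z) ≼ (x ⊞ y) ⊞ z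
⊞-assoc-≽ x y z = ≼-reflexive λ n → sym (ℚ.+-assoc (x n) (y n) (z n))

⊞-comm-≼ : ∀ x y → x ⊞ y ≼ y ⊞ x
⊞-comm-≼ x y = ≼-reflexive λ n → ℚ.+-comm (x n) (y n)

interchange-≼ : ∀ x y u v → (x ⊞ y) ⊞ (u ⊞ v) ≼ (x ⊞ u) ⊞ (y ⊞ v)
interchange-≼ x y u v = ≼-reflexive λ n →
  interchange (x n) (y n) (u n) (v n)

⊡-monoʳ-≼ : ∀ n {x y} → x ≼ y → n ⊡ x ≼ n ⊡ y
⊡-monoʳ-≼ zero    x≼y = ≼-refl
⊡-monoʳ-≼ (suc n) x≼y = ⊞-mono-≼ x≼y (⊡-monoʳ-≼ n x≼y)

infixr 2 _≼⟨_⟩_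
infix  3 _■

_≼⟨_⟩_ : ∀ x {y z} → x ≼ y → y ≼ z → x ≼ z
x ≼⟨ p ⟩ q = ≼-trans p q

_■ : ∀ x → x ≼ x
x ■ = ≼-refl

⊡-distribˡ-≼ : ∀ n x y → n ⊡ (x ⊞ y) ≼ n ⊡ x ⊞ n ⊡ y
⊡-distribˡ-≼ zero    x y = ⊞-identityʳ-≼ {0ˢ}
⊡-distribˡ-≼ (suc n) x y =
  (x ⊞ y) ⊞ n ⊡ (x ⊞ y)       ≼⟨ ⊞-mono-≼ {x ⊞ y} {x ⊞ y} {n ⊡ (x ⊞ y)} ≼-refl (⊡-distribˡ-≼ n x y) ⟩
  (x ⊞ y) ⊞ (n ⊡ x ⊞ n ⊡ y)   ≼⟨ interchange-≼ x y (n ⊡ x) (n ⊡ y) ⟩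
  (x ⊞ n ⊡ x) ⊞ (y ⊞ n ⊡ y)   ■

⊡-distribˡ-≽ : ∀ n x y → n ⊡ x ⊞ n ⊡ y ≼ n ⊡ (x ⊞ y)
⊡-distribˡ-≽ zero    x y = ⊞-identityʳ-≽ {0ˢ}
⊡-distribˡ-≽ (suc n) x y =
  (x ⊞ n ⊡ x) ⊞ (y ⊞ n ⊡ y)   ≼⟨ interchange-≼ x (n ⊡ x) y (n ⊡ y) ⟩
  (x ⊞ y) ⊞ (n ⊡ x ⊞ n ⊡ y)   ≼⟨ ⊞-mono-≼ {x ⊞ y} {x ⊞ y} {_} {n ⊡ (x ⊞ y)} ≼-refl (⊡-distribˡ-≽ n x y) ⟩
  (x ⊞ y) ⊞ n ⊡ (x ⊞ y)       ■

const-mono-≼ : ∀ {p q} → p ℚ.≤ q → const p ≼ const q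
const-mono-≼ p≤q = ≼-pointwise λ _ → p≤q

const-mono-≺ : ∀ {p q} → p ℚ.< q → const p ≺ const q
const-mono-≺ {p} {q} p<q = ⟨ q ℚ.- p , 0<q-p , 0 , (λ _ _ → ℚ.≤-reflexive (begin
    p ℚ.+ (q ℚ.- p)   ≡⟨ ℚ.+-comm p (q ℚ.- p) ⟩
    (q ℚ.- p) ℚ.+ p   ≡⟨ //-rightDividesˡ p q ⟩
    q                 ∎)) ⟩
  where
  open ≡-Reasoning
  0<q-p : 0ℚ ℚ.< q ℚ.- p
  0<q-p = subst (ℚ._< q ℚ.- p) (ℚ.+-inverseʳ p) (ℚ.+-monoˡ-< (ℚ.- p) p<q)

const-cancel-≺ : ∀ {p q} → const p ≺ const q → p ℚ.< q
const-cancel-≺ {p} {q} ⟨ ε , 0<ε , N , h ⟩ = begin-strict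
  p            ≡⟨ ℚ.+-identityʳ p ⟨
  p ℚ.+ 0ℚ     <⟨ ℚ.+-monoʳ-< p 0<ε ⟩
  p ℚ.+ ε      ≤⟨ h N ≤-refl ⟩
  q            ∎
  where open ℚ.≤-Reasoning

-- Multiples of 1/D

toℚᵘ-/ : ∀ a d .{{_ : NonZero d}} → ℚ.toℚᵘ (+ a / d) ℚᵘ.≃ + a ℚᵘ./ d
toℚᵘ-/ a (suc d) = ℚ.toℚᵘ-fromℚᵘ (ℚᵘ.mkℚᵘ (+ a) d)

module Scaled (D : ℕ) .{{_ : NonZero D}} where

  -- Outside this block `frac a` does not unfold to a fraction in lowest terms; only its sums, its
  -- order and its values at 0 and `D` are used there.
  abstract
    frac : ℕ → ℚ
    frac a = + a / D

    fracᵘ : ∀ a → ℚ.toℚᵘ (frac a) ℚᵘ.≃ + a ℚᵘ./ D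
    fracᵘ a = toℚᵘ-/ a D

    /-+ : ∀ a b d .{{_ : NonZero d}} → (+ a ℚᵘ./ d) ℚᵘ.+ (+ b ℚᵘ./ d) ℚᵘ.≃ + (a + b) ℚᵘ./ d
    /-+ a b (suc d) = ℚᵘ.*≡* (begin
      (+ a ℤ.* + suc d ℤ.+ + b ℤ.* + suc d) ℤ.* + suc d   ≡⟨ cong (ℤ._* + suc d) (ℤ.*-distribʳ-+ (+ suc d) (+ a) (+ b)) ⟨
      + (a + b) ℤ.* + suc d ℤ.* + suc d            ≡⟨ ℤ.*-assoc (+ (a + b)) (+ suc d) (+ suc d) ⟩
      + (a + b) ℤ.* (+ suc d ℤ.* + suc d)          ∎)
      where
      open ≡-Reasoning

    frac-+ : ∀ a b → frac a ℚ.+ frac b ≡ frac (a + b)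
    frac-+ a b = ℚ.toℚᵘ-injective (begin
      ℚ.toℚᵘ (frac a ℚ.+ frac b)             ≈⟨ ℚ.toℚᵘ-homo-+ (frac a) (frac b) ⟩
      ℚ.toℚᵘ (frac a) ℚᵘ.+ ℚ.toℚᵘ (frac b)   ≈⟨ ℚᵘ.+-cong (fracᵘ a) (fracᵘ b) ⟩
      (+ a ℚᵘ./ D) ℚᵘ.+ (+ b ℚᵘ./ D)         ≈⟨ /-+ a b D ⟩
      + (a + b) ℚᵘ./ D                     ≈⟨ fracᵘ (a + b) ⟨
      ℚ.toℚᵘ (frac (a + b))                ∎)
      where open ℚᵘ.≃-Reasoning

    frac-mono-< : ∀ {a b} → a < b → frac a ℚ.< frac b
    frac-mono-< {a} {b} a<b = ℚ.toℚᵘ-cancel-<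
      (ℚᵘ.<-respˡ-≃ (ℚᵘ.≃-sym (fracᵘ a)) (ℚᵘ.<-respʳ-≃ (ℚᵘ.≃-sym (fracᵘ b)) (lemma D)))
      where
      lemma : ∀ d .{{_ : NonZero d}} → + a ℚᵘ./ d ℚᵘ.< + b ℚᵘ./ d
      lemma (suc d) = ℚᵘ.*<* (ℤ.*-monoʳ-<-pos (+ suc d) (ℤ.+<+ a<b))

    frac-0 : frac 0 ≡ 0ℚ
    frac-0 = ℚ.0/n≡0 D

    frac-D : frac D ≡ 1ℚ
    frac-D = ℚ.toℚᵘ-injective (ℚᵘ.≃-trans (fracᵘ D) (lemma D))
      where
      lemma : ∀ d .{{_ : NonZero d}} → + d ℚᵘ./ d ℚᵘ.≃ ℚ.toℚᵘ 1ℚ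
      lemma (suc d) = ℚᵘ.*≡* (trans (ℤ.*-identityʳ (+ suc d)) (sym (ℤ.*-identityˡ (+ suc d))))

  ⟦_⟧ : ℕ → ℝ
  ⟦ a ⟧ = fromℚ (frac a)

  ⟪_⟫ : ℕ → Seq
  ⟪ a ⟫ = const (frac a)

  ⟪⟫-mono-≼ : ∀ {a b} → a ≤ b → ⟪ a ⟫ ≼ ⟪ b ⟫
  ⟪⟫-mono-≼ a≤b with m≤n⇒m<n∨m≡n a≤b
  ... | inj₁ a<b  = const-mono-≼ (ℚ.<⇒≤ (frac-mono-< a<b))
  ... | inj₂ refl = ≼-refl

  ⟪⟫-mono-≺ : ∀ {a b} → a < b → ⟪ a ⟫ ≺ ⟪ b ⟫
  ⟪⟫-mono-≺ a<b = const-mono-≺ (frac-mono-< a<b)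

  -- The way back from ℝ to ℕ: the order on ℕ is decidable, and the opposite strict inequality would
  -- give an absurd one between rationals.
  ⟪⟫-cancel-≼ : ∀ a b → ⟪ a ⟫ ≼ ⟪ b ⟫ → a ≤ b
  ⟪⟫-cancel-≼ a b le = ≮⇒≥ λ b<a →
    ℚ.<-irrefl refl (const-cancel-≺ (≺-≼-trans (⟪⟫-mono-≺ b<a) le))

  ⟪⟫-cancel-≺ : ∀ a b → ⟪ a ⟫ ≺ ⟪ b ⟫ → a < b
  ⟪⟫-cancel-≺ a b lt = ≰⇒> λ b≤a →
    ℚ.<-irrefl refl (const-cancel-≺ (≺-≼-trans lt (⟪⟫-mono-≼ b≤a)))

  ⟪⟫-+-≼ : ∀ a b → ⟪ a ⟫ ⊞ ⟪ b ⟫ ≼ ⟪ a + b ⟫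
  ⟪⟫-+-≼ a b = ≼-reflexive λ _ → frac-+ a b

  ⟪⟫-+-≽ : ∀ a b → ⟪ a + b ⟫ ≼ ⟪ a ⟫ ⊞ ⟪ b ⟫
  ⟪⟫-+-≽ a b = ≼-reflexive λ _ → sym (frac-+ a b)

  ·-⟦⟧ : ∀ m a n → approx (m ℝ.· ⟦ a ⟧) n ≡ frac (m * a)
  ·-⟦⟧ zero    a n = sym frac-0
  ·-⟦⟧ (suc m) a n = trans (cong (frac a ℚ.+_) (·-⟦⟧ m a n)) (frac-+ a (m * a))

  ⊡-⟪⟫ : ∀ m a n → (m ⊡ ⟪ a ⟫) n ≡ frac (m * a)
  ⊡-⟪⟫ zero    a n = sym frac-0
  ⊡-⟪⟫ (suc m) a n = trans (cong (frac a ℚ.+_) (⊡-⟪⟫ m a n)) (frac-+ a (m * a))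

  ·-1ℝ : ∀ m n → approx (m ℝ.· 1ℝ) n ≡ frac (m * D)
  ·-1ℝ zero    n = sym frac-0
  ·-1ℝ (suc m) n = trans (cong₂ ℚ._+_ (sym frac-D) (·-1ℝ m n)) (frac-+ D (m * D))

  ⟦⟧-floor : ∀ a b k → k * b ≤ a → a < suc k * b → ⌊ ⟦ a ⟧ ÷ ⟦ b ⟧ ⌋≡ k
  ⟦⟧-floor a b k lo hi =
    ≼⇒≤ (≼-trans (≼-reflexive (·-⟦⟧ k b)) (⟪⟫-mono-≼ lo)) ,
    ≺⇒< (≺-≼-trans (⟪⟫-mono-≺ hi) (≼-reflexive (sym ∘ ·-⟦⟧ (suc k) b)))

  -- Whatever value `f` the floor relation admits is pinned down by integer inequalities, so
  -- undecidable floors leave no ambiguity in the coloring.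
  floor-⟦⟧ : ∀ n a {f} → ⌊ n ℝ.· ⟦ a ⟧ ⌋≡ f → f * D ≤ n * a × n * a < suc f * D
  floor-⟦⟧ n a {f} (lo , hi) =
    ⟪⟫-cancel-≼ (f * D) (n * a) (≼-trans (≼-reflexive (sym ∘ ·-1ℝ f))
      (≼-trans ⟨ lo ⟩ (≼-reflexive (·-⟦⟧ n a)))) ,
    ⟪⟫-cancel-≺ (n * a) (suc f * D) (≼-≺-trans (≼-reflexive (sym ∘ ·-⟦⟧ n a))
      (≺-≼-trans ⟨ hi ⟩ (≼-reflexive (·-1ℝ (suc f)))))

-- Branch and bound for the unbounded knapsack problem

∧ˡ : ∀ {a b} → T (a ∧ b) → T a
∧ˡ {true} _ = _

∧ʳ : ∀ {a b} → T (a ∧ b) → T b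
∧ʳ {true} t = t

∨⁻ : ∀ a {b} → T (a ∨ b) → T a ⊎ T b
∨⁻ a = Equivalence.to (T-∨ {a})

module Knapsack (unit : ℕ) .{{_ : NonZero unit}} where

  -- The density is an upper bound on profit / weight in units of 1/unit.
  record Object : Set where
    constructor object
    field
      density weight profit : ℕ

  open Object public

  -- The successor after the division rounds the density up; `suc (w ∸ 1)` is a positive `w` in a
  -- form that division accepts. Objects without profit get density 0, so they are sorted last and
  -- pruned at once, whatever their weight.
  withDensity : ℕ → ℕ → Object
  withDensity w zero = object 0 w 0
  withDensity w p@(suc _) = object (suc (unit * p ℕ./ suc (w ∸ 1))) w p

  -- Checked by evaluation on the sorted list. This is what soundness relies on, so of `sort` only
  -- `sort-∈` has to be proved.
  dense : ℕ → List Object → Bool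
  dense d []       = true
  dense d (x ∷ xs) = (density x ≤ᵇ d) ∧ (unit * profit x ≤ᵇ density x * weight x) ∧ dense (density x) xs

  insert : Object → List Object → List Object
  insert x [] = x ∷ []
  insert x (y ∷ ys) with density y ≤ᵇ density x
  ... | true  = x ∷ y ∷ ys
  ... | false = y ∷ insert x ys

  sort : List Object → List Object
  sort []       = []
  sort (x ∷ xs) = insert x (sort xs)

  insert-∈ : ∀ {x} y xs → x ∈ y ∷ xs → x ∈ insert y xs
  insert-∈ y []       x∈ = x∈
  insert-∈ y (z ∷ zs) x∈ with density z ≤ᵇ density y
  ... | true  = x∈
  insert-∈ y (z ∷ zs) (here refl)         | false = there (insert-∈ y zs (here refl))
  insert-∈ y (z ∷ zs) (there (here refl)) | false = here refl
  insert-∈ y (z ∷ zs) (there (there x∈))  | false = there (insert-∈ y zs (there x∈))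

  sort-∈ : ∀ {x} xs → x ∈ xs → x ∈ sort xs
  sort-∈ (y ∷ ys) (here refl) = insert-∈ y (sort ys) (here refl)
  sort-∈ (y ∷ ys) (there x∈)  = insert-∈ y (sort ys) (there (sort-∈ ys x∈))

  Σweight Σprofit : List Object → ℕ
  Σweight xs = sum (map weight xs)
  Σprofit xs = sum (map profit xs)

  -- Is p an upper bound on the profit of all multisets of objects of total
  -- weight at most c?  The first argument bounds the depth of the search.
  bounded : ℕ → List Object → ℕ → ℕ → Bool
  bounded zero    _        c p = false
  bounded (suc n) []       c p = true
  bounded (suc n) (x ∷ xs) c p =
    (density x * c ≤ᵇ unit * p) ∨
    (((c <ᵇ weight x) ∨ ((profit x ≤ᵇ p) ∧ bounded n (x ∷ xs) (c ∸ weight x) (p ∸ profit x)))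
     ∧ bounded n xs c p)

  dense-weaken : ∀ {d e} xs → d ≤ e → T (dense d xs) → T (dense e xs)
  dense-weaken []       d≤e t = _
  dense-weaken {d} {e} (x ∷ xs) d≤e t =
    Equivalence.from (T-∧ {density x ≤ᵇ e})
      (≤⇒≤ᵇ (≤-trans (≤ᵇ⇒≤ (density x) d (∧ˡ t)) d≤e) , ∧ʳ {density x ≤ᵇ _} t)

  dense-∈ : ∀ {d x} xs → T (dense d xs) → x ∈ xs → unit * profit x ≤ d * weight x
  dense-∈ {d} (x ∷ xs) t (here refl) =
    ≤-trans (≤ᵇ⇒≤ (unit * profit x) (density x * weight x) (∧ˡ (∧ʳ {density x ≤ᵇ d} t)))
            (*-monoˡ-≤ (weight x) (≤ᵇ⇒≤ (density x) d (∧ˡ t)))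
  dense-∈ {d} (x ∷ xs) t (there x∈) = dense-∈ xs
    (dense-weaken xs (≤ᵇ⇒≤ (density x) d (∧ˡ t)) (∧ʳ {unit * profit x ≤ᵇ _} (∧ʳ {density x ≤ᵇ d} t))) x∈

  dense-Σ : ∀ {d xs} ys → T (dense d xs) → All (_∈ xs) ys → unit * Σprofit ys ≤ d * Σweight ys
  dense-Σ {d} [] t [] = ≤-reflexive (trans (*-zeroʳ unit) (sym (*-zeroʳ d)))
  dense-Σ {d} {xs} (y ∷ ys) t (y∈ ∷ ys∈) = begin
    unit * (profit y + Σprofit ys)          ≡⟨ *-distribˡ-+ unit (profit y) _ ⟩
    unit * profit y + unit * Σprofit ys     ≤⟨ +-mono-≤ (dense-∈ xs t y∈) (dense-Σ ys t ys∈) ⟩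
    d * weight y + d * Σweight ys           ≡⟨ *-distribˡ-+ d (weight y) _ ⟨
    d * (weight y + Σweight ys)             ∎
    where open ≤-Reasoning

  remove : ∀ {x xs} ys → All (_∈ x ∷ xs) ys → All (_∈ xs) ys ⊎
           ∃ λ zs → All (_∈ x ∷ xs) zs × Σweight ys ≡ weight x + Σweight zs
                                       × Σprofit ys ≡ profit x + Σprofit zs
  remove [] [] = inj₁ []
  remove (y ∷ ys) (here refl ∷ ys∈) = inj₂ (ys , ys∈ , refl , refl)
  remove {x} (y ∷ ys) (there y∈ ∷ ys∈) with remove ys ys∈
  ... | inj₁ ys∈xs = inj₁ (y∈ ∷ ys∈xs)
  ... | inj₂ (zs , zs∈ , w , p) = inj₂ (y ∷ zs , there y∈ ∷ zs∈ ,
    trans (cong (_+_ (weight y)) w) (x∙yz≈y∙xz (weight y) (weight x) _) ,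
    trans (cong (_+_ (profit y)) p) (x∙yz≈y∙xz (profit y) (profit x) _))

  -- If the density bound does not settle the matter, either `ys` contains `x`, and one copy is
  -- removed while `x` stays available, or all of `ys` lies in `xs`. An exhausted depth answers
  -- `false`, so it never validates a bound.
  bounded-sound : ∀ n {d xs c p} → T (dense d xs) → T (bounded n xs c p) →
                  ∀ ys → All (_∈ xs) ys → Σweight ys ≤ c → Σprofit ys ≤ p
  bounded-sound (suc n) {xs = []} _ _ [] [] _ = z≤n
  bounded-sound (suc n) {d} {xs = x ∷ xs} {c} {p} δ t ys ys∈ ys≤c
    with ∨⁻ (density x * c ≤ᵇ unit * p) t
  ... | inj₁ prune = *-cancelˡ-≤ unit (begin
    unit * Σprofit ys        ≤⟨ dense-Σ ys δ′ ys∈ ⟩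
    density x * Σweight ys   ≤⟨ *-monoʳ-≤ (density x) ys≤c ⟩
    density x * c            ≤⟨ ≤ᵇ⇒≤ _ _ prune ⟩
    unit * p                 ∎)
    where
    open ≤-Reasoning
    δ′ : T (dense (density x) (x ∷ xs))
    δ′ = Equivalence.from (T-∧ {density x ≤ᵇ density x})
      (≤⇒≤ᵇ {density x} ≤-refl , ∧ʳ {density x ≤ᵇ d} δ)
  ... | inj₂ branch with remove ys ys∈
  ...   | inj₁ ys∈xs = bounded-sound n (∧ʳ {unit * profit x ≤ᵇ _} (∧ʳ {density x ≤ᵇ d} δ))
                         (∧ʳ {(c <ᵇ weight x) ∨ _} branch) ys ys∈xs ys≤c
  ...   | inj₂ (zs , zs∈ , w , q) with ∨⁻ (c <ᵇ weight x) (∧ˡ branch)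
  ...     | inj₁ heavy = contradiction (begin-strict
    c                         <⟨ <ᵇ⇒< c (weight x) heavy ⟩
    weight x                  ≤⟨ m≤m+n (weight x) (Σweight zs) ⟩
    weight x + Σweight zs     ≡⟨ w ⟨
    Σweight ys                ≤⟨ ys≤c ⟩
    c                         ∎) (<-irrefl refl)
    where open ≤-Reasoning
  ...     | inj₂ take = begin
    Σprofit ys                    ≡⟨ q ⟩
    profit x + Σprofit zs         ≤⟨ +-monoʳ-≤ (profit x) rest ⟩
    profit x + (p ∸ profit x)     ≡⟨ m+[n∸m]≡n (≤ᵇ⇒≤ (profit x) p (∧ˡ take)) ⟩
    p                             ∎
    where
    open ≤-Reasoning
    rest : Σprofit zs ≤ p ∸ profit x
    rest = bounded-sound n δ (∧ʳ {profit x ≤ᵇ p} take) zs zs∈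
      (subst (_≤ c ∸ weight x) (trans (cong (_∸ weight x) w) (m+n∸m≡n (weight x) _))
        (∸-monoˡ-≤ (weight x) ys≤c))

-- Invariants of the packing

_≟ᶜ_ : (c d : Color) → Dec (c ≡ d)
blue ≟ᶜ blue = yes refl
blue ≟ᶜ red  = no λ ()
red  ≟ᶜ blue = no λ ()
red  ≟ᶜ red  = yes refl

module Counting (P : SuperHarmonic) where
  open SuperHarmonic P using (M; K; leaves; needs; bluefit; redfit)
  open Execution P

  when : Color → Type → Color → Type → ℕ → ℕ
  when c i d j x with c ≟ᶜ d | i Fin.≟ j
  ... | yes _ | yes _ = x
  ... | yes _ | no  _ = 0
  ... | no  _ | _     = 0

  when-+ : ∀ c i d j x y → when c i d j (x + y) ≡ when c i d j x + when c i d j y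
  when-+ c i d j x y with c ≟ᶜ d | i Fin.≟ j
  ... | yes _ | yes _ = refl
  ... | yes _ | no  _ = refl
  ... | no  _ | _     = refl

  when-refl : ∀ c i x → when c i c i x ≡ x
  when-refl c i x with c ≟ᶜ c | i Fin.≟ i
  ... | yes _ | yes _ = refl
  ... | yes _ | no i≢i = contradiction refl i≢i
  ... | no c≢c | _     = contradiction refl c≢c

  when-0 : ∀ c i d j → when c i d j 0 ≡ 0
  when-0 c i d j with c ≟ᶜ d | i Fin.≟ j
  ... | yes _ | yes _ = refl
  ... | yes _ | no  _ = refl
  ... | no  _ | _     = refl

  module Tally (f : Color → Type → ℕ → ℕ) where

    tallyBin : Color → Type → Bin → ℕ
    tallyBin c i (pureBlue j b)    = when c i blue j (f blue j b)
    tallyBin c i (unmixed d j m)   = when c i d j (f d j m)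
    tallyBin c i (mixed j b k r)   = when c i blue j (f blue j b) + when c i red k (f red k r)

    tally : Color → Type → List Bin → ℕ
    tally c i []       = 0
    tally c i (b ∷ bs) = tallyBin c i b + tally c i bs

    -- The change of `f` when a group grows is given as a balance, so that one lemma covers a rise
    -- (`items`, with 0 and 1) and a fall (`deficit`, with 1 and 0) without subtraction.
    module _ {c : Color} {i : Type} {x y : ℕ} (f-suc : ∀ {m} → m < maxFit c i → f c i (suc m) + x ≡ f c i m + y) where

      private
        when-suc : ∀ d j {m} → m < maxFit c i →
                   when d j c i (f c i (suc m)) + when d j c i x ≡
                   when d j c i (f c i m) + when d j c i y
        when-suc d j {m} m<fit = begin
          when d j c i (f c i (suc m)) + when d j c i x   ≡⟨ when-+ d j c i _ _ ⟨
          when d j c i (f c i (suc m) + x)                ≡⟨ cong (when d j c i) (f-suc m<fit) ⟩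
          when d j c i (f c i m + y)                      ≡⟨ when-+ d j c i _ _ ⟩
          when d j c i (f c i m) + when d j c i y         ∎
          where open ≡-Reasoning

        rearrange : ∀ a u b v {u′ v′} → u + v ≡ u′ + v′ → (a + u + b) + v ≡ (a + u′ + b) + v′
        rearrange a u b v {u′} {v′} eq = begin
          (a + u + b) + v    ≡⟨ shift a u b v ⟩
          a + b + (u + v)    ≡⟨ cong (_+_ (a + b)) eq ⟩
          a + b + (u′ + v′)  ≡⟨ shift a u′ b v′ ⟨
          (a + u′ + b) + v′  ∎
          where
          open ≡-Reasoning
          shift : ∀ a u b v → (a + u + b) + v ≡ a + b + (u + v)
          shift = solve-∀

        rearrange′ : ∀ a u v {u′ v′} → u + v ≡ u′ + v′ → (a + u) + v ≡ (a + u′) + v′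
        rearrange′ a u v {u′} {v′} eq =
          trans (+-assoc a u v) (trans (cong (_+_ a) eq) (sym (+-assoc a u′ v′)))

      tallyBin-open : ∀ d j {b b′} → AddToOpen c i b b′ →
                      tallyBin d j b′ + when d j c i x ≡ tallyBin d j b + when d j c i y
      tallyBin-open d j (pureBlue lt)  = when-suc d j lt
      tallyBin-open d j (unmixed lt)   = when-suc d j lt
      tallyBin-open d j (mixedBlue {b = b} {j = k} {r} lt) =
        rearrange 0 (when d j blue i (f blue i (suc b))) (when d j red k (f red k r)) _
          {when d j blue i (f blue i b)} (when-suc d j lt)
      tallyBin-open d j (mixedRed {i = k} {b} {r = r} lt) =
        rearrange′ (when d j blue k (f blue k b)) (when d j red i (f red i (suc r))) _
          {when d j red i (f red i r)} (when-suc d j lt)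

      tally-open : ∀ d j {bs bs′} → InSomeBin (AddToOpen c i) bs bs′ →
                   tally d j bs′ + when d j c i x ≡ tally d j bs + when d j c i y
      tally-open d j (here {b} {b′} {bs} a) =
        rearrange 0 (tallyBin d j b′) (tally d j bs) _ {tallyBin d j b} (tallyBin-open d j a)
      tally-open d j (there {b} {bs} {bs′} a) =
        rearrange′ (tallyBin d j b) (tally d j bs′) _ {tally d j bs} (tally-open d j a)

    tally-compatible : ∀ d j {c i bs bs′} → InSomeBin (AddToCompatible c i) bs bs′ →
                       tally d j bs′ ≡ when d j c i (f c i 1) + tally d j bs
    tally-compatible d j {i = i} (here {bs = bs} (redToBlue {j = k} {b} _)) =
      trans (cong (_+ tally d j bs) (+-comm (when d j blue k (f blue k b)) _))
            (+-assoc (when d j red i (f red i 1)) _ _)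
    tally-compatible d j {i = i} (here (blueToRed _)) =
      +-assoc (when d j blue i (f blue i 1)) _ _
    tally-compatible d j {c} {i} (there {b} {bs} {bs′} a) = begin
      tallyBin d j b + tally d j bs′              ≡⟨ cong (_+_ (tallyBin d j b)) (tally-compatible d j {c} {i} {bs} {bs′} a) ⟩
      tallyBin d j b + (w + tally d j bs)         ≡⟨ +-assoc (tallyBin d j b) w _ ⟨
      tallyBin d j b + w + tally d j bs           ≡⟨ cong (_+ tally d j bs) (+-comm (tallyBin d j b) w) ⟩
      w + tallyBin d j b + tally d j bs           ≡⟨ +-assoc w _ _ ⟩
      w + (tallyBin d j b + tally d j bs)         ∎
      where
      open ≡-Reasoning
      w = when d j c i (f c i 1)

    tally-new : ∀ d j c i bs → tally d j (newBin c i ∷ bs) ≡ when d j c i (f c i 1) + tally d j bs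
    tally-new d j red  i bs = refl
    tally-new d j blue i bs with leaves i
    ... | zero  = refl
    ... | suc _ = refl

  items deficit : Color → Type → ℕ → ℕ
  items   c i m = m
  deficit c i m = maxFit c i ∸ m

  open Tally

  private
    fits⇒deficit : ∀ {m n} → m < n → n ∸ suc m + 1 ≡ n ∸ m + 0
    fits⇒deficit {m} {n} m<n = begin
      n ∸ suc m + 1       ≡⟨ +-comm (n ∸ suc m) 1 ⟩
      suc (n ∸ suc m)     ≡⟨ +-∸-assoc 1 m<n ⟨
      n ∸ m               ≡⟨ +-identityʳ (n ∸ m) ⟨
      n ∸ m + 0           ∎
      where open ≡-Reasoning

  tally-items : ∀ d j {c i bs bs′} → Place c i bs bs′ →
                tally items d j bs′ ≡ when d j c i 1 + tally items d j bs
  tally-items d j {c} {i} {bs} {bs′} (open-bin a) = begin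
    tally items d j bs′                    ≡⟨ +-identityʳ _ ⟨
    tally items d j bs′ + 0                ≡⟨ cong (_+_ (tally items d j bs′)) (when-0 d j c i) ⟨
    tally items d j bs′ + when d j c i 0   ≡⟨ tally-open items {x = 0} {1} (λ {m} _ → trans (+-comm (suc m) 0) (+-comm 1 m)) d j a ⟩
    tally items d j bs + when d j c i 1    ≡⟨ +-comm (tally items d j bs) _ ⟩
    when d j c i 1 + tally items d j bs    ∎
    where
    open ≡-Reasoning
  tally-items d j (compatible-bin _ a)         = tally-compatible items d j a
  tally-items d j {c} {i} {bs} (new-bin _ _)        = tally-new items d j c i bs

  -- `Place` only records the negation that no bin is open. Bins are finite data, so openness can be
  -- decided, and the negation becomes the usable fact that no group of this color and type misses
  -- an item.
  open⊎full : ∀ c i bs → ∃ (InSomeBin (AddToOpen c i) bs) ⊎ tally deficit c i bs ≡ 0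
  open⊎full c i [] = inj₂ refl
  open⊎full c i (b ∷ bs) with openBin⊎full b
    where
    part : ∀ d j m → (c ≡ d × i ≡ j × m < maxFit d j) ⊎ when c i d j (maxFit d j ∸ m) ≡ 0
    part d j m with c ≟ᶜ d | i Fin.≟ j
    ... | no _     | _    = inj₂ refl
    ... | yes _    | no _ = inj₂ refl
    ... | yes refl | yes refl with m <? maxFit d j
    ...   | yes m<fit = inj₁ (refl , refl , m<fit)
    ...   | no  m≮fit = inj₂ (m≤n⇒m∸n≡0 (≮⇒≥ m≮fit))

    openBin⊎full : ∀ b → ∃ (AddToOpen c i b) ⊎ tallyBin deficit c i b ≡ 0
    openBin⊎full (pureBlue j m) with part blue j m
    ... | inj₁ (refl , refl , lt) = inj₁ (_ , pureBlue lt)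
    ... | inj₂ eq                 = inj₂ eq
    openBin⊎full (unmixed d j m) with part d j m
    ... | inj₁ (refl , refl , lt) = inj₁ (_ , unmixed lt)
    ... | inj₂ eq                 = inj₂ eq
    openBin⊎full (mixed j m k r) with part blue j m | part red k r
    ... | inj₁ (refl , refl , lt) | _                       = inj₁ (_ , mixedBlue lt)
    ... | inj₂ _                  | inj₁ (refl , refl , lt) = inj₁ (_ , mixedRed lt)
    ... | inj₂ eq                 | inj₂ eq′                = inj₂ (cong₂ _+_ eq eq′)
  ... | inj₁ (_ , a) = inj₁ (_ , here a)
  ... | inj₂ eq with open⊎full c i bs
  ...   | inj₁ (_ , a) = inj₁ (_ , there a)
  ...   | inj₂ eq′     = inj₂ (cong₂ _+_ eq eq′)

  when-cases : ∀ c i d j → (c ≡ d × i ≡ j) ⊎ (∀ x → when c i d j x ≡ 0)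
  when-cases c i d j with c ≟ᶜ d | i Fin.≟ j
  ... | yes p | yes q = inj₁ (p , q)
  ... | yes _ | no  _ = inj₂ λ _ → refl
  ... | no  _ | _     = inj₂ λ _ → refl

  -- At most one bin is c-open for type i, since a group is only started
  -- when the deficit is 0.
  module _ {c : Color} {i : Type} {bs : List Bin} (bounded : ∀ d j → tally deficit d j bs ≤ maxFit d j) where

    start-bounded : ¬ ∃ (InSomeBin (AddToOpen c i) bs) → ∀ d j →
                    when d j c i (maxFit c i ∸ 1) + tally deficit d j bs ≤ maxFit d j
    start-bounded noOpen d j with when-cases d j c i
    ... | inj₂ zero′ rewrite zero′ (maxFit c i ∸ 1) = bounded d j
    ... | inj₁ (refl , refl) with open⊎full c i bs
    ...   | inj₁ isOpen = contradiction isOpen noOpen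
    ...   | inj₂ full   = begin
      when c i c i (maxFit c i ∸ 1) + tally deficit c i bs   ≡⟨ cong₂ _+_ (when-refl c i _) full ⟩
      maxFit c i ∸ 1 + 0                                     ≡⟨ +-identityʳ _ ⟩
      maxFit c i ∸ 1                                         ≤⟨ m∸n≤m (maxFit c i) 1 ⟩
      maxFit c i                                             ∎
      where open ≤-Reasoning

    deficit-bounded : ∀ {bs′} → Place c i bs bs′ → ∀ d j → tally deficit d j bs′ ≤ maxFit d j
    deficit-bounded {bs′} (open-bin a) d j = begin
      tally deficit d j bs′                    ≤⟨ m≤m+n _ _ ⟩
      tally deficit d j bs′ + when d j c i 1   ≡⟨ tally-open deficit fits⇒deficit d j a ⟩
      tally deficit d j bs + when d j c i 0    ≡⟨ cong (_+_ (tally deficit d j bs)) (when-0 d j c i) ⟩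
      tally deficit d j bs + 0                 ≡⟨ +-identityʳ _ ⟩
      tally deficit d j bs                     ≤⟨ bounded d j ⟩
      maxFit d j                               ∎
      where open ≤-Reasoning
    deficit-bounded (compatible-bin noOpen a) d j =
      subst (_≤ maxFit d j) (sym (tally-compatible deficit d j a)) (start-bounded noOpen d j)
    deficit-bounded (new-bin noOpen _) d j =
      subst (_≤ maxFit d j) (sym (tally-new deficit d j c i bs)) (start-bounded noOpen d j)

  -- Writes the increment of a counter with `when`, to match that of `tally-items`. The color `d` is
  -- free, since the counter of all items of a type has none.
  updateAt-suc : ∀ d (xs : Vector ℕ (suc M)) i j → updateAt xs i suc j ≡ when d j d i 1 + xs j
  updateAt-suc blue xs i j with j Fin.≟ i
  ... | yes refl = updateAt-updates i xs
  ... | no  j≢i  = updateAt-minimal j i xs j≢i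
  updateAt-suc red xs i j with j Fin.≟ i
  ... | yes refl = updateAt-updates i xs
  ... | no  j≢i  = updateAt-minimal j i xs j≢i

  -- Incompatibility of the unmixed bins, and the least need

  Incompatible : List Bin → Set
  Incompatible bs = ∀ {i j b r} → unmixed blue i b ∈ bs → unmixed red j r ∈ bs → leaves i Fin.< needs j

  BinOK : Bin → Set
  BinOK (pureBlue i _)     = toℕ (leaves i) ≡ 0
  BinOK (unmixed blue _ _) = ⊤
  BinOK (unmixed red j _)  = 0 < toℕ (needs j)
  BinOK (mixed _ _ j _)    = 0 < toℕ (needs j)

  module _ {R : Bin → Bin → Set} where

    InSome-∈ : ∀ {b b′ bs} → b ∈ bs → R b b′ → ∃ (InSomeBin R bs)
    InSome-∈ (here refl) r = _ , here r
    InSome-∈ (there b∈) r with InSome-∈ b∈ r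
    ... | _ , a = _ , there a

    InSome-unmixed : (∀ {b c i m} → R b (unmixed c i m) → ∃ λ n → b ≡ unmixed c i n) →
                     ∀ {bs bs′ c i m} → InSomeBin R bs bs′ →
                     unmixed c i m ∈ bs′ → ∃ λ n → unmixed c i n ∈ bs
    InSome-unmixed inv (here r)  (here refl) with inv r
    ... | n , refl = n , here refl
    InSome-unmixed inv (here r)  (there b∈)  = _ , there b∈
    InSome-unmixed inv (there a) (here refl) = _ , here refl
    InSome-unmixed inv (there a) (there b∈) with InSome-unmixed inv a b∈
    ... | n , b∈′ = n , there b∈′

    InSome-All : {Q : Bin → Set} → (∀ {b b′} → R b b′ → Q b → Q b′) →
                 ∀ {bs bs′} → InSomeBin R bs bs′ → All Q bs → All Q bs′
    InSome-All pres (here r)  (q ∷ qs) = pres r q ∷ qs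
    InSome-All pres (there a) (q ∷ qs) = q ∷ InSome-All pres a qs

  open-unmixed : ∀ {d j b c i m} → AddToOpen d j b (unmixed c i m) → ∃ λ n → b ≡ unmixed c i n
  open-unmixed (unmixed _) = _ , refl

  compatible-unmixed : ∀ {d j b c i m} → AddToCompatible d j b (unmixed c i m) → ∃ λ n → b ≡ unmixed c i n
  compatible-unmixed ()

  incompatible-old : ∀ {bs bs′} → (∀ {c i m} → unmixed c i m ∈ bs′ → ∃ λ n → unmixed c i n ∈ bs) →
                     Incompatible bs → Incompatible bs′
  incompatible-old old inc u v = inc (proj₂ (old u)) (proj₂ (old v))

  -- Only a new bin can bring a new kind of unmixed bin, and it is opened only if no unmixed bin is
  -- compatible with the item.
  incompatible-step : ∀ {c i bs bs′} → Place c i bs bs′ → Incompatible bs → Incompatible bs′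
  incompatible-step (open-bin a)         inc = incompatible-old (InSome-unmixed open-unmixed a) inc
  incompatible-step (compatible-bin _ a) inc = incompatible-old (InSome-unmixed compatible-unmixed a) inc
  incompatible-step {red} {i} (new-bin _ none) inc = λ where
    (there u) (here refl) → ≰⇒> λ le → none (InSome-∈ u (redToBlue le))
    (there u) (there v)   → inc u v
  incompatible-step {blue} {i} {bs} (new-bin _ none) inc = new
    where
    new : Incompatible (newBin blue i ∷ bs)
    new u v with leaves i in eq
    new (there u)   (there v) | zero  = inc u v
    new (there u)   (there v) | suc _ = inc u v
    new (here refl) (there v) | suc _ = ≰⇒> λ le → none (InSome-∈ v (blueToRed le))

  ok-open : ∀ {c i b b′} → AddToOpen c i b b′ → BinOK b → BinOK b′
  ok-open (pureBlue _)         ok = ok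
  ok-open (unmixed {blue} _)   ok = ok
  ok-open (unmixed {red} _)    ok = ok
  ok-open (mixedBlue _)        ok = ok
  ok-open (mixedRed _)         ok = ok

  ok-step : ∀ {c i bs bs′} → (c ≡ red → 0 < toℕ (needs i)) → Place c i bs bs′ → All BinOK bs → All BinOK bs′
  ok-step pos (open-bin a) = InSome-All ok-open a
  ok-step pos (compatible-bin _ a) = InSome-All ok-compatible a
    where
    ok-compatible : ∀ {b b′} → AddToCompatible _ _ b b′ → BinOK b → BinOK b′
    ok-compatible (redToBlue _) _  = pos refl
    ok-compatible (blueToRed _) ok = ok
  ok-step {red}      pos (new-bin _ _) oks = pos refl ∷ oks
  ok-step {blue} {i} pos (new-bin _ _) oks = new ∷ oks
    where
    new : BinOK (newBin blue i)
    new with leaves i in eq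
    ... | zero  = cong toℕ eq
    ... | suc _ = _

  -- Without unmixed red bins the value is `suc K`, above all values of `leaves` and `needs`: every
  -- blue group then has `leaves` below it, and every red group is of the kind that sits in mixed
  -- bins.
  leastNeed : List Bin → ℕ
  leastNeed []                     = suc K
  leastNeed (unmixed red j _ ∷ bs) = toℕ (needs j) ⊓ leastNeed bs
  leastNeed (_ ∷ bs)               = leastNeed bs

  -- Used with 0, to see that the least need is positive, and with `leaves i` of an unmixed blue
  -- bin, which `Incompatible` puts below all needs of unmixed red bins.
  <-leastNeed : ∀ {m} → m < suc K → ∀ bs →
                (∀ {j r} → unmixed red j r ∈ bs → m < toℕ (needs j)) → m < leastNeed bs
  <-leastNeed m≤K []                      _ = m≤K
  <-leastNeed m≤K (pureBlue _ _     ∷ bs) h = <-leastNeed m≤K bs (h ∘ there)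
  <-leastNeed m≤K (unmixed blue _ _ ∷ bs) h = <-leastNeed m≤K bs (h ∘ there)
  <-leastNeed m≤K (unmixed red _ _  ∷ bs) h = ⊓-pres-m< (h (here refl)) (<-leastNeed m≤K bs (h ∘ there))
  <-leastNeed m≤K (mixed _ _ _ _    ∷ bs) h = <-leastNeed m≤K bs (h ∘ there)

  leastNeed-≤ : ∀ bs {j r} → unmixed red j r ∈ bs → leastNeed bs ≤ toℕ (needs j)
  leastNeed-≤ (unmixed red _ _  ∷ bs) (here refl) = m⊓n≤m _ _
  leastNeed-≤ (pureBlue _ _     ∷ bs) (there u)   = leastNeed-≤ bs u
  leastNeed-≤ (unmixed blue _ _ ∷ bs) (there u)   = leastNeed-≤ bs u
  leastNeed-≤ (unmixed red _ _  ∷ bs) (there u)   = ≤-trans (m⊓n≤n _ _) (leastNeed-≤ bs u)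
  leastNeed-≤ (mixed _ _ _ _    ∷ bs) (there u)   = leastNeed-≤ bs u

  leastNeed-≤sucK : ∀ bs → leastNeed bs ≤ suc K
  leastNeed-≤sucK []                      = ≤-refl
  leastNeed-≤sucK (unmixed red _ _  ∷ bs) = ≤-trans (m⊓n≤n _ _) (leastNeed-≤sucK bs)
  leastNeed-≤sucK (pureBlue _ _     ∷ bs) = leastNeed-≤sucK bs
  leastNeed-≤sucK (unmixed blue _ _ ∷ bs) = leastNeed-≤sucK bs
  leastNeed-≤sucK (mixed _ _ _ _    ∷ bs) = leastNeed-≤sucK bs

-- Weights

Σ-mono : ∀ {n} {f g : Vector ℕ n} → (∀ i → f i ≤ g i) → Σ f ≤ Σ g
Σ-mono {zero}  f≤g = z≤n
Σ-mono {suc n} f≤g = +-mono-≤ (f≤g zero) (Σ-mono (f≤g ∘ suc))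

*-distribˡ-Σ : ∀ {n} c (f : Vector ℕ n) → c * Σ f ≡ Σ λ i → c * f i
*-distribˡ-Σ {zero}  c f = *-zeroʳ c
*-distribˡ-Σ {suc n} c f = trans (*-distribˡ-+ c (f zero) _) (cong (_+_ (c * f zero)) (*-distribˡ-Σ c (tail f)))

Σ-0 : ∀ {n} {f : Vector ℕ n} → (∀ i → f i ≡ 0) → Σ f ≡ 0
Σ-0 {zero}  f≡0 = refl
Σ-0 {suc n} f≡0 = cong₂ _+_ (f≡0 zero) (Σ-0 (f≡0 ∘ suc))

Σ-single : ∀ {n} (f : Vector ℕ n) i → (∀ j → j ≢ i → f j ≡ 0) → Σ f ≡ f i
Σ-single f zero    h = trans (cong (_+_ (f zero)) (Σ-0 λ j → h (suc j) λ ())) (+-identityʳ (f zero))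
Σ-single f (suc i) h = cong₂ _+_ (h zero λ ()) (Σ-single (tail f) i λ j j≢i → h (suc j) (j≢i ∘ Fin.suc-injective))

f≤Σ : ∀ {n} (f : Vector ℕ n) i → f i ≤ Σ f
f≤Σ f zero    = m≤m+n _ _
f≤Σ f (suc i) = ≤-trans (f≤Σ (tail f) i) (m≤n+m _ (f zero))

module Weights (P : SuperHarmonic) where
  open SuperHarmonic P using (M; K; leaves; needs; bluefit; redfit)
  open Execution P
  open Counting P
  open Tally

  ΣΣ : (Color → Type → ℕ) → ℕ
  ΣΣ h = Σ (λ i → h blue i + h red i)

  partSum : (Color → Type → ℕ → ℕ) → Bin → ℕ
  partSum f (pureBlue i b)  = f blue i b
  partSum f (unmixed c i m) = f c i m
  partSum f (mixed i b j r) = f blue i b + f red j r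

  totalSum : (Color → Type → ℕ → ℕ) → List Bin → ℕ
  totalSum f []       = 0
  totalSum f (b ∷ bs) = partSum f b + totalSum f bs

  ΣΣ-+ : ∀ h k → ΣΣ (λ c i → h c i + k c i) ≡ ΣΣ h + ΣΣ k
  ΣΣ-+ h k = trans (Σ-cong λ i → +-interchange (h blue i) (k blue i) (h red i) (k red i))
                   (Σ-+ (λ i → h blue i + h red i) (λ i → k blue i + k red i))

  ΣΣ-cong : ∀ h k → (∀ c i → h c i ≡ k c i) → ΣΣ h ≡ ΣΣ k
  ΣΣ-cong h k eq = Σ-cong λ i → cong₂ _+_ (eq blue i) (eq red i)

  when-≢ : ∀ c {i j} d x → i ≢ j → when c i d j x ≡ 0
  when-≢ c {i} {j} d x i≢j with when-cases c i d j
  ... | inj₁ (_ , i≡j) = contradiction i≡j i≢j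
  ... | inj₂ zero′     = zero′ x

  ΣΣ-when : ∀ (ν : Color → Type → ℕ) d j x → ΣΣ (λ c i → ν c i * when c i d j x) ≡ ν d j * x
  ΣΣ-when ν d j x = trans (Σ-single _ j others) (at d)
    where
    open ≡-Reasoning
    others : ∀ i → i ≢ j → ν blue i * when blue i d j x + ν red i * when red i d j x ≡ 0
    others i i≢j = cong₂ _+_
      (trans (cong (ν blue i *_) (when-≢ blue d x i≢j)) (*-zeroʳ (ν blue i)))
      (trans (cong (ν red  i *_) (when-≢ red  d x i≢j)) (*-zeroʳ (ν red i)))
    at : ∀ d → ν blue j * when blue j d j x + ν red j * when red j d j x ≡ ν d j * x
    at blue = trans (cong₂ _+_ (cong (ν blue j *_) (when-refl blue j x)) (*-zeroʳ (ν red j))) (+-identityʳ _)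
    at red  = cong₂ _+_ (*-zeroʳ (ν blue j)) (cong (ν red j *_) (when-refl red j x))

  -- Double counting: a sum over the groups in the bins is collected by color and type.
  totalSum-tally : ∀ (ν : Color → Type → ℕ) (f : Color → Type → ℕ → ℕ) bs →
    totalSum (λ c i m → ν c i * f c i m) bs ≡ ΣΣ (λ c i → ν c i * tally f c i bs)
  totalSum-tally ν f []       = sym (Σ-0 λ i → cong₂ _+_ (*-zeroʳ (ν blue i)) (*-zeroʳ (ν red i)))
  totalSum-tally ν f (b ∷ bs) = begin
    partSum νf b + totalSum νf bs
      ≡⟨ cong₂ _+_ (bin b) (totalSum-tally ν f bs) ⟩
    ΣΣ (head b) + ΣΣ rest
      ≡⟨ ΣΣ-+ (head b) rest ⟨
    ΣΣ (λ c i → head b c i + rest c i)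
      ≡⟨ ΣΣ-cong (λ c i → ν c i * tally f c i (b ∷ bs)) (λ c i → head b c i + rest c i)
                 (λ c i → *-distribˡ-+ (ν c i) (tallyBin f c i b) (tally f c i bs)) ⟨
    ΣΣ (λ c i → ν c i * tally f c i (b ∷ bs))
      ∎
    where
    open ≡-Reasoning
    νf : Color → Type → ℕ → ℕ
    νf c i m = ν c i * f c i m
    head : Bin → Color → Type → ℕ
    head b c i = ν c i * tallyBin f c i b
    rest : Color → Type → ℕ
    rest c i = ν c i * tally f c i bs
    bin : ∀ b → partSum νf b ≡ ΣΣ (head b)
    bin (pureBlue j m)  = sym (ΣΣ-when ν blue j (f blue j m))
    bin (unmixed d j m) = sym (ΣΣ-when ν d j (f d j m))
    bin (mixed j m k r) = begin
      νf blue j m + νf red k r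
        ≡⟨ cong₂ _+_ (ΣΣ-when ν blue j (f blue j m)) (ΣΣ-when ν red k (f red k r)) ⟨
      ΣΣ (head (pureBlue j m)) + ΣΣ (head (unmixed red k r))
        ≡⟨ ΣΣ-+ (head (pureBlue j m)) (head (unmixed red k r)) ⟨
      ΣΣ (λ c i → head (pureBlue j m) c i + head (unmixed red k r) c i)
        ≡⟨ ΣΣ-cong (head (mixed j m k r)) (λ c i → head (pureBlue j m) c i + head (unmixed red k r) c i)
             (λ c i → *-distribˡ-+ (ν c i) _ _) ⟨
      ΣΣ (head (mixed j m k r))
        ∎

  totalSum-mono : ∀ {f g} → (∀ c i m → f c i m ≤ g c i m) → ∀ bs → totalSum f bs ≤ totalSum g bs
  totalSum-mono f≤g []       = z≤n
  totalSum-mono f≤g (b ∷ bs) = +-mono-≤ (bin b) (totalSum-mono f≤g bs)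
    where
    bin : ∀ b → partSum _ b ≤ partSum _ b
    bin (pureBlue i m)  = f≤g blue i m
    bin (unmixed c i m) = f≤g c i m
    bin (mixed i m j r) = +-mono-≤ (f≤g blue i m) (f≤g red j r)

  totalSum-+ : ∀ f g bs → totalSum (λ c i m → f c i m + g c i m) bs ≡ totalSum f bs + totalSum g bs
  totalSum-+ f g []       = refl
  totalSum-+ f g (b ∷ bs) = trans (cong₂ _+_ (bin b) (totalSum-+ f g bs))
                                  (+-interchange (partSum f b) (partSum g b) (totalSum f bs) (totalSum g bs))
    where
    bin : ∀ b → partSum (λ c i m → f c i m + g c i m) b ≡ partSum f b + partSum g b
    bin (pureBlue i m)  = refl
    bin (unmixed c i m) = refl
    bin (mixed i m j r) = +-interchange (f blue i m) (g blue i m) (f red j r) (g red j r)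

  -- If k is the least need of the unmixed red bins, then every blue
  -- group with leaves ≥ k and every red group with needs < k is in a
  -- mixed bin.  So the number of bins is at most the number of the
  -- other blue groups plus that of all red groups, and at most the
  -- number of all blue groups plus that of the other red groups;
  -- groupWeight takes l/D times the first bound plus 1 - l/D times the
  -- second (and scales by D).
  groupWeight : (D l k : ℕ) → Color → Type → ℕ
  groupWeight D l k blue i = if toℕ (leaves i) <ᵇ k then D else D ∸ l
  groupWeight D l k red  i = if k ≤ᵇ toℕ (needs i) then D else l

  module _ (D l : ℕ) (l≤D : l ≤ D) where

    private
      true-if : ∀ {b x y} → T b → x ≤ (if b then x else y)
      true-if {true} _ = ≤-refl

      blue-≥ : ∀ k i → D ∸ l ≤ groupWeight D l k blue i
      blue-≥ k i with toℕ (leaves i) <ᵇ k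
      ... | true  = m∸n≤m D l
      ... | false = ≤-refl

      red-≥ : ∀ k j → l ≤ groupWeight D l k red j
      red-≥ k j with k ≤ᵇ toℕ (needs j)
      ... | true  = l≤D
      ... | false = ≤-refl

    bins-≤-groupWeight : ∀ k bs → 0 < k → All BinOK bs →
      (∀ {i b} → unmixed blue i b ∈ bs → toℕ (leaves i) < k) →
      (∀ {j r} → unmixed red j r ∈ bs → k ≤ toℕ (needs j)) →
      D * length bs ≤ totalSum (λ c i _ → groupWeight D l k c i) bs
    bins-≤-groupWeight k [] 0<k oks hb hr = ≤-reflexive (*-zeroʳ D)
    bins-≤-groupWeight k (b ∷ bs) 0<k (ok ∷ oks) hb hr = begin
      D * suc (length bs)            ≡⟨ *-suc D (length bs) ⟩
      D + D * length bs              ≤⟨ +-mono-≤ (bin b ok (hb ∘ here) (hr ∘ here))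
                                          (bins-≤-groupWeight k bs 0<k oks (hb ∘ there) (hr ∘ there)) ⟩
      partSum g b + totalSum g bs    ∎
      where
      open ≤-Reasoning
      g = λ c i (_ : ℕ) → groupWeight D l k c i
      bin : ∀ b → BinOK b →
            (∀ {i m} → unmixed blue i m ≡ b → toℕ (leaves i) < k) →
            (∀ {j r} → unmixed red j r ≡ b → k ≤ toℕ (needs j)) → D ≤ partSum g b
      bin (pureBlue i _) ok _ _ = true-if (<⇒<ᵇ (subst (_< k) (sym ok) 0<k))
      bin (unmixed blue i _) _ hb _ = true-if (<⇒<ᵇ (hb refl))
      bin (unmixed red j _) _ _ hr = true-if (≤⇒≤ᵇ (hr refl))
      -- The two groups of a mixed bin share its cost: they weigh at least `D ∸ l` and `l`, whatever
      -- their `leaves` and `needs`.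
      bin (mixed i _ j _) _ _ _ =
        ≤-trans (≤-reflexive (sym (m∸n+n≡m l≤D))) (+-mono-≤ (blue-≥ k i) (red-≥ k j))

  -- A group is charged for the items that it holds and for those that it misses, hence at least as
  -- much as a full group. The missing items form the second sum, which `bounded` later turns into a
  -- constant.
  groups-≤-items : ∀ Y (g ν : Color → Type → ℕ) → (∀ c i → Y * g c i ≤ maxFit c i * ν c i) → ∀ bs →
    Y * totalSum (λ c i _ → g c i) bs ≤
    ΣΣ (λ c i → ν c i * tally items c i bs) + ΣΣ (λ c i → ν c i * tally deficit c i bs)
  groups-≤-items Y g ν Yg≤ bs = begin
    Y * totalSum (λ c i _ → g c i) bs
      ≡⟨ *-distribˡ-total bs ⟩
    totalSum (λ c i _ → Y * g c i) bs
      ≤⟨ totalSum-mono full bs ⟩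
    totalSum (λ c i m → ν c i * m + ν c i * (maxFit c i ∸ m)) bs
      ≡⟨ totalSum-+ (λ c i m → ν c i * m) (λ c i m → ν c i * (maxFit c i ∸ m)) bs ⟩
    totalSum (λ c i m → ν c i * items c i m) bs + totalSum (λ c i m → ν c i * deficit c i m) bs
      ≡⟨ cong₂ _+_ (totalSum-tally ν items bs) (totalSum-tally ν deficit bs) ⟩
    ΣΣ (λ c i → ν c i * tally items c i bs) + ΣΣ (λ c i → ν c i * tally deficit c i bs)
      ∎
    where
    open ≤-Reasoning
    *-distribˡ-total : ∀ bs → Y * totalSum (λ c i _ → g c i) bs ≡ totalSum (λ c i _ → Y * g c i) bs
    *-distribˡ-total []                   = *-zeroʳ Y
    *-distribˡ-total (pureBlue _ _  ∷ bs) = trans (*-distribˡ-+ Y _ _) (cong (_+_ _) (*-distribˡ-total bs))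
    *-distribˡ-total (unmixed _ _ _ ∷ bs) = trans (*-distribˡ-+ Y _ _) (cong (_+_ _) (*-distribˡ-total bs))
    *-distribˡ-total (mixed _ _ _ _ ∷ bs) =
      trans (*-distribˡ-+ Y _ _) (cong₂ _+_ (*-distribˡ-+ Y _ _) (*-distribˡ-total bs))
    full : ∀ c i m → Y * g c i ≤ ν c i * m + ν c i * (maxFit c i ∸ m)
    full c i m = begin
      Y * g c i                                 ≤⟨ Yg≤ c i ⟩
      maxFit c i * ν c i                        ≡⟨ *-comm (maxFit c i) (ν c i) ⟩
      ν c i * maxFit c i                        ≤⟨ *-monoʳ-≤ (ν c i) (m≤n+m∸n (maxFit c i) m) ⟩
      ν c i * (m + (maxFit c i ∸ m))            ≡⟨ *-distribˡ-+ (ν c i) m _ ⟩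
      ν c i * m + ν c i * (maxFit c i ∸ m)      ∎

Σ-updateAt : ∀ {n} (f ω : Vector ℕ n) i → Σ (λ j → updateAt f i suc j * ω j) ≡ ω i + Σ (λ j → f j * ω j)
Σ-updateAt f ω zero    = +-assoc (ω zero) (f zero * ω zero) _
Σ-updateAt f ω (suc i) = trans (cong (_+_ (f zero * ω zero)) (Σ-updateAt (tail f) (tail ω) i))
                                 (x∙yz≈y∙xz (f zero * ω zero) (ω (suc i)) _)

-- Runs with integral parameters, compared with an optimal packing

record Integral (P : SuperHarmonic) (D : ℕ) .{{_ : NonZero D}} : Set where
  open SuperHarmonic P renaming (red to redFraction)
  open Scaled D
  field
    α low    : Fin (suc M) → ℕ
    τ        : ℕ
    red≡     : ∀ i → redFraction i ≡ ⟦ α i ⟧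
    α≤D      : ∀ i → α i ≤ D
    needs>0  : ∀ i → 0 < α i → 0 < toℕ (needs i)
    low≼     : ∀ i → ⟪ low i ⟫ ≼ approx (lowerEnd t i)
    t≼τ      : approx (t (fromℕ M)) ≼ ⟪ τ ⟫
    τ≤D      : τ ≤ D

module Analysis (P : SuperHarmonic) (D : ℕ) .{{_ : NonZero D}} (I : Integral P D) where
  open SuperHarmonic P using (M; K; t; leaves; needs; bluefit; redfit)
  open Execution P
  open Counting P
  open Tally
  open Weights P
  open Scaled D
  open Integral I

  -- That is, the red count is the floor of the item count times the share. As the share is at most
  -- 1, this floor grows by at most 1 per item, so coloring the new item suffices to keep up with
  -- it.
  Balanced : Type → ℕ → ℕ → Set
  Balanced i n r = r * D ≤ n * α i × n * α i < suc r * D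

  red-floor : ∀ i n f → ⌊ n ℝ.· SuperHarmonic.red P i ⌋≡ f →
              f * D ≤ n * α i × n * α i < suc f * D
  red-floor i n f fl = floor-⟦⟧ n (α i) {f} (subst (λ x → ⌊ n ℝ.· x ⌋≡ f) (red≡ i) fl)

  balanced-red : ∀ {i n r} → ColorOf i (suc n) r red → Balanced i n r → Balanced i (suc n) (suc r)
  balanced-red {i} {n} {r} (red {f} fl r<f) (_ , hi) = ≤-trans (*-monoˡ-≤ D r<f) (proj₁ f-floor) , (begin-strict
    α i + n * α i      <⟨ +-mono-≤-< (α≤D i) hi ⟩
    D + suc r * D      ∎)
    where
    open ≤-Reasoning
    f-floor = red-floor i (suc n) f fl

  balanced-blue : ∀ {i n r} → ColorOf i (suc n) r blue → Balanced i n r → Balanced i (suc n) r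
  balanced-blue {i} {n} {r} (blue {f} fl f≤r) (lo , _) =
    ≤-trans lo (m≤n+m _ (α i)) , <-≤-trans (proj₂ f-floor) (*-monoˡ-≤ D (s≤s f≤r))
    where
    f-floor = red-floor i (suc n) f fl

  red-needs : ∀ {i n r} → ColorOf i n r red → 0 < toℕ (needs i)
  red-needs {i} {n} (red {suc f} fl _) = needs>0 i (n≢0⇒n>0 λ α≡0 → <⇒≱ (>-nonZero⁻¹ D) (begin
    D            ≤⟨ m≤m+n D (f * D) ⟩
    suc f * D    ≤⟨ proj₁ (red-floor i n (suc f) fl) ⟩
    n * α i      ≡⟨ cong (n *_) α≡0 ⟩
    n * 0        ≡⟨ *-zeroʳ n ⟩
    0            ∎))
    where
    open ≤-Reasoning

  -- The current bin, at the head, may have any nonnegative level; a closed one lacks less than the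
  -- size of the type N item that did not fit, hence at most `τ`.
  Full : List ℝ → Set
  Full []       = ⊤
  Full (l ∷ ls) = ⟪ 0 ⟫ ≼ approx l × All (λ l → ⟪ D ∸ τ ⟫ ≼ approx l) ls

  record Invariant (s : State) : Set where
    field
      blueItems    : ∀ i → tally items blue i (bins s) + redCount s i ≡ count s i
      redItems     : ∀ i → tally items red i (bins s) ≡ redCount s i
      balanced     : ∀ i → Balanced i (count s i) (redCount s i)
      bounded      : ∀ c i → tally deficit c i (bins s) ≤ maxFit c i
      incompatible : Incompatible (bins s)
      ok           : All BinOK (bins s)
      full         : Full (binsN s)

  open Invariant

  inv-initial : Invariant initial
  inv-initial = record
    { blueItems = λ _ → refl ; redItems = λ _ → refl
    ; balanced = λ _ → z≤n , >-nonZero⁻¹ _ {{m*n≢0 1 D}}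
    ; bounded = λ _ _ → z≤n ; incompatible = λ () ; ok = [] ; full = _ }

  private
    balanced-update : ∀ {n r : Vector ℕ (suc M)} {i c} → ColorOf i (suc (n i)) (r i) c →
                      (∀ j → Balanced j (n j) (r j)) →
                      ∀ j → Balanced j (updateAt n i suc j) (countRed c i r j)
    balanced-update {n} {r} {i} {red} col bal j
      rewrite updateAt-suc red n i j | updateAt-suc red r i j with j Fin.≟ i
    ... | yes refl = balanced-red col (bal j)
    ... | no  _    = bal j
    balanced-update {n} {r} {i} {blue} col bal j
      rewrite updateAt-suc blue n i j with j Fin.≟ i
    ... | yes refl = balanced-blue col (bal j)
    ... | no  _    = bal j

    blue-update : ∀ {n r : Vector ℕ (suc M)} {i c bs bs′} → Place c i bs bs′ →
                  (∀ j → tally items blue j bs + r j ≡ n j) →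
                  ∀ j → tally items blue j bs′ + countRed c i r j ≡ updateAt n i suc j
    blue-update {n} {r} {i} {red} {bs} pl eq j
      rewrite tally-items blue j pl | updateAt-suc red n i j | updateAt-suc red r i j | sym (eq j) =
      x∙yz≈y∙xz (tally items blue j bs) (when red j red i 1) (r j)
    blue-update {n} {r} {i} {blue} {bs} pl eq j
      rewrite tally-items blue j pl | updateAt-suc blue n i j | sym (eq j) =
      +-assoc (when blue j blue i 1) (tally items blue j bs) (r j)

    red-update : ∀ {r : Vector ℕ (suc M)} {i c bs bs′} → Place c i bs bs′ →
                 (∀ j → tally items red j bs ≡ r j) →
                 ∀ j → tally items red j bs′ ≡ countRed c i r j
    red-update {r} {i} {red} pl eq j
      rewrite tally-items red j pl | updateAt-suc red r i j = cong (_+_ (when red j red i 1)) (eq j)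
    red-update {r} {i} {blue} pl eq j rewrite tally-items red j pl = eq j

  0≼size : ∀ x → ⟪ 0 ⟫ ≼ approx (size x)
  0≼size x = ≼-trans (≼-reflexive λ _ → frac-0) (≺⇒≼ ⟨ positive x ⟩)

  full-step : ∀ {x ls ls′} → HasType x typeN → NextFit (size x) ls ls′ → Full ls → Full ls′
  full-step {x} _ first _ = 0≼size x , []
  full-step {x} _ (fits {l} _) (0≼l , ls-full) =
    ≼-trans (≼-reflexive λ _ → sym (frac-+ 0 0)) (⊞-mono-≼ 0≼l (0≼size x)) , ls-full
  full-step {x} (_ , x≤t) (opens {l} 1<l+x) (_ , ls-full) = 0≼size x , l-full ∷ ls-full
    where
    l-full : ⟪ D ∸ τ ⟫ ≼ approx l
    l-full = ⊞-cancelʳ-≼ ⟪ τ ⟫ (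
      ⟪ D ∸ τ ⟫ ⊞ ⟪ τ ⟫          ≼⟨ ⟪⟫-+-≼ (D ∸ τ) τ ⟩
      ⟪ D ∸ τ + τ ⟫              ≼⟨ ⟪⟫-mono-≼ (≤-reflexive (m∸n+n≡m τ≤D)) ⟩
      ⟪ D ⟫                      ≼⟨ ≼-reflexive (λ _ → frac-D) ⟩
      approx 1ℝ                  ≼⟨ ≺⇒≼ ⟨ 1<l+x ⟩ ⟩
      approx l ⊞ approx (size x) ≼⟨ ⊞-mono-≼ (≼-refl {approx l}) (≼-trans ⟨ x≤t ⟩ t≼τ) ⟩
      approx l ⊞ ⟪ τ ⟫           ■)

  inv-step : ∀ {x s s′} → Step x s s′ → Invariant s → Invariant s′
  inv-step {x} (stepN ty nf) inv = record
    { blueItems = blueItems inv ; redItems = redItems inv ; balanced = balanced inv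
    ; bounded = bounded inv ; incompatible = incompatible inv ; ok = ok inv
    ; full = full-step {x} ty nf (full inv) }
  inv-step (step {n} {nʳ} _ _ col pl) inv = record
    { blueItems = blue-update pl (blueItems inv)
    ; redItems  = red-update pl (redItems inv)
    ; balanced  = balanced-update col (balanced inv)
    ; bounded   = deficit-bounded (bounded inv) pl
    ; incompatible = incompatible-step pl (incompatible inv)
    ; ok        = ok-step (λ { refl → red-needs col }) pl (ok inv)
    ; full      = full inv }

  inv-run : ∀ {s σ s′} → Run s σ s′ → Invariant s → Invariant s′
  inv-run []         inv = inv
  inv-run (st ∷ run) inv = inv-run run (inv-step st inv)

  Typed : Item → Set
  Typed x = ∃ (HasType x)

  -- Types are read off the typing proofs, as they cannot be computed from real sizes; the lemmas
  -- below carry these proofs along permutations and concatenations.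
  types : ∀ {xs} → All Typed xs → List Type
  types []              = []
  types ((i , _) ∷ ps)  = i ∷ types ps

  sizes : List Item → Seq
  sizes xs = approx (ℝ.sum (map size xs))

  types-↭ : ∀ {xs ys} (f : Type → ℕ) → xs ↭ ys → (ps : All Typed xs) →
            Σ[ qs ∈ All Typed ys ] sum (map f (types ps)) ≡ sum (map f (types qs))
  types-↭ f refl ps = ps , refl
  types-↭ f (prep x p) (px ∷ ps) with types-↭ f p ps
  ... | qs , eq = px ∷ qs , cong (_+_ (f (proj₁ px))) eq
  types-↭ f (swap x y p) (px ∷ py ∷ ps) with types-↭ f p ps
  ... | qs , eq = py ∷ px ∷ qs , trans (x∙yz≈y∙xz (f (proj₁ px)) (f (proj₁ py)) _)
                                       (cong (λ z → f (proj₁ py) + (f (proj₁ px) + z)) eq)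
  types-↭ f (_↭_.trans p q) ps with types-↭ f p ps
  ... | qs , eq with types-↭ f q qs
  ...   | rs , eq′ = rs , trans eq eq′

  types-++ : ∀ (f : Type → ℕ) xs {ys} (ps : All Typed (xs ++ ys)) →
             Σ[ qs ∈ All Typed xs ] Σ[ rs ∈ All Typed ys ]
             sum (map f (types ps)) ≡ sum (map f (types qs)) + sum (map f (types rs))
  types-++ f []       ps        = [] , ps , refl
  types-++ f (x ∷ xs) (px ∷ ps) with types-++ f xs ps
  ... | qs , rs , eq = px ∷ qs , rs , trans (cong (_+_ (f (proj₁ px))) eq) (sym (+-assoc (f (proj₁ px)) _ _))

  sizes-↭ : ∀ {xs ys} → xs ↭ ys → sizes xs ≼ sizes ys
  sizes-↭ refl         = ≼-refl
  sizes-↭ (prep x p)   = ⊞-mono-≼ (≼-refl {approx (size x)}) (sizes-↭ p)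
  sizes-↭ {_ ∷ _ ∷ xs} {_ ∷ _ ∷ ys} (swap x y p) =
    a ⊞ (b ⊞ sizes xs)    ≼⟨ ⊞-assoc-≽ a b (sizes xs) ⟩
    (a ⊞ b) ⊞ sizes xs    ≼⟨ ⊞-mono-≼ (⊞-comm-≼ a b) (sizes-↭ p) ⟩
    (b ⊞ a) ⊞ sizes ys    ≼⟨ ⊞-assoc-≼ b a (sizes ys) ⟩
    b ⊞ (a ⊞ sizes ys)    ■
    where
    a = approx (size x)
    b = approx (size y)
  sizes-↭ (_↭_.trans p q)  = ≼-trans (sizes-↭ p) (sizes-↭ q)

  sizes-++ : ∀ xs ys → sizes (xs ++ ys) ≼ sizes xs ⊞ sizes ys
  sizes-++ []       ys = ≼-trans (⊞-identityʳ-≼ {sizes ys}) (⊞-comm-≼ (sizes ys) 0ˢ)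
  sizes-++ (x ∷ xs) ys =
    ≼-trans (⊞-mono-≼ (≼-refl {approx (size x)}) (sizes-++ xs ys)) (⊞-assoc-≽ (approx (size x)) (sizes xs) (sizes ys))

  low-≼-sizes : ∀ {xs} (ps : All Typed xs) → ⟪ sum (map low (types ps)) ⟫ ≼ sizes xs
  low-≼-sizes [] = ≼-reflexive λ _ → frac-0
  low-≼-sizes {x ∷ xs} ((i , lo , _) ∷ ps) =
    ≼-trans (⟪⟫-+-≽ (low i) _) (⊞-mono-≼ (≼-trans (low≼ i) (≺⇒≼ ⟨ lo ⟩)) (low-≼-sizes ps))

  -- Strict, because an item exceeds its lower end by a positive gap; hence the knapsack capacity
  -- `pred D`. This keeps two items above 1/2 out of one bin even where their lower ends add up to
  -- exactly `D`.
  low-<-D : ∀ {xs} (ps : All Typed xs) → ℝ.sum (map size xs) ℝ.≤ 1ℝ → sum (map low (types ps)) < D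
  low-<-D [] _ = >-nonZero⁻¹ D
  low-<-D {x ∷ xs} ((i , lo , _) ∷ ps) fit = ⟪⟫-cancel-≺ _ D (≼-≺-trans (⟪⟫-+-≽ (low i) _)
    (≺-≼-trans (⊞-mono-≺-≼ (≼-≺-trans (low≼ i) ⟨ lo ⟩) (low-≼-sizes ps))
      (≼-trans ⟨ fit ⟩ (≼-reflexive λ _ → sym frac-D))))

  ⊡-⟪⟫-≼ : ∀ m a → m ⊡ ⟪ a ⟫ ≼ ⟪ m * a ⟫
  ⊡-⟪⟫-≼ m a = ≼-reflexive (⊡-⟪⟫ m a)

  ⊡-⟪⟫-≽ : ∀ m a → ⟪ m * a ⟫ ≼ m ⊡ ⟪ a ⟫
  ⊡-⟪⟫-≽ m a = ≼-reflexive (sym ∘ ⊡-⟪⟫ m a)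

  module _ (e : Type → ℕ) (B : ℕ)
           (knapsack : ∀ is → sum (map low is) < D → sum (map e is) ≤ B) where

    concat-bound : ∀ bs (ps : All Typed (concat bs)) →
                   All (λ b → ℝ.sum (map size b) ℝ.≤ 1ℝ) bs →
                   sum (map e (types ps)) ≤ length bs * B
    concat-bound []       [] [] = z≤n
    concat-bound (b ∷ bs) ps (fit ∷ rest) with types-++ e b ps
    ... | qs , rs , eq = begin
      sum (map e (types ps))                            ≡⟨ eq ⟩
      sum (map e (types qs)) + sum (map e (types rs))   ≤⟨ +-mono-≤ (knapsack (types qs) (low-<-D qs fit)) (concat-bound bs rs rest) ⟩
      B + length bs * B                                 ∎
      where open ≤-Reasoning

  concat-sizes : ∀ bs → All (λ b → ℝ.sum (map size b) ℝ.≤ 1ℝ) bs → sizes (concat bs) ≼ ⟪ length bs * D ⟫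
  concat-sizes []       []           = ≼-reflexive λ _ → sym frac-0
  concat-sizes (b ∷ bs) (fit ∷ rest) =
    sizes (b ++ concat bs)            ≼⟨ sizes-++ b (concat bs) ⟩
    sizes b ⊞ sizes (concat bs)       ≼⟨ ⊞-mono-≼ (≼-trans ⟨ fit ⟩ (≼-reflexive λ _ → sym frac-D)) (concat-sizes bs rest) ⟩
    ⟪ D ⟫ ⊞ ⟪ length bs * D ⟫         ≼⟨ ⟪⟫-+-≼ D (length bs * D) ⟩
    ⟪ D + length bs * D ⟫             ■

  itemWeight : (Color → Type → ℕ) → Type → ℕ
  itemWeight ν i = (D ∸ α i) * ν blue i + α i * ν red i

  -- By `Balanced`, the red items are at most their share of all `n`, and the blue ones at most the
  -- remaining share plus one item, which gives the last term.
  colored-≤-items : ∀ ν i {b r n} → b + r ≡ n → Balanced i n r →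
                    D * (ν blue i * b + ν red i * r) ≤ n * itemWeight ν i + ν blue i * D
  colored-≤-items ν i {b} {r} {n} b+r≡n (lo , hi) = begin
    D * (ν blue i * b + ν red i * r)
      ≡⟨ expand D (ν blue i) b (ν red i) r ⟩
    ν blue i * (D * b) + ν red i * (r * D)
      ≤⟨ +-mono-≤ (*-monoʳ-≤ (ν blue i) Db≤) (*-monoʳ-≤ (ν red i) lo) ⟩
    ν blue i * (n * (D ∸ α i) + D) + ν red i * (n * α i)
      ≡⟨ collect (ν blue i) n (D ∸ α i) D (ν red i) (α i) ⟩
    n * itemWeight ν i + ν blue i * D
      ∎
    where
    open ≤-Reasoning
    expand : ∀ D u b v r → D * (u * b + v * r) ≡ u * (D * b) + v * (r * D)
    expand = solve-∀
    collect : ∀ u n a D v c → u * (n * a + D) + v * (n * c) ≡ n * (a * u + c * v) + u * D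
    collect = solve-∀
    Db≤ : D * b ≤ n * (D ∸ α i) + D
    Db≤ = +-cancelʳ-≤ (r * D) _ _ (begin
      D * b + r * D                      ≡⟨ factor D b r ⟩
      (b + r) * D                        ≡⟨ cong₂ _*_ b+r≡n (sym (m∸n+n≡m (α≤D i))) ⟩
      n * (D ∸ α i + α i)                ≡⟨ *-distribˡ-+ n (D ∸ α i) (α i) ⟩
      n * (D ∸ α i) + n * α i            ≤⟨ +-monoʳ-≤ (n * (D ∸ α i)) (<⇒≤ hi) ⟩
      n * (D ∸ α i) + (D + r * D)        ≡⟨ +-assoc (n * (D ∸ α i)) D (r * D) ⟨
      n * (D ∸ α i) + D + r * D          ∎)
      where
      factor : ∀ D b r → D * b + r * D ≡ (b + r) * D
      factor = solve-∀

  module _ (Y l : ℕ) (l≤D : l ≤ D) (k : ℕ) (ν : Color → Type → ℕ)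
           (ν-full : ∀ c i → Y * groupWeight D l k c i ≤ maxFit c i * ν c i) where

    -- Independent of the input: one blue item per type for the rounding of shares, and the missing
    -- items of at most one full group per color and type.
    slack : ℕ
    slack = Σ (λ i → ν blue i * D) + D * ΣΣ (λ c i → ν c i * maxFit c i)

    bins-≤-items : ∀ {s} → Invariant s → leastNeed (bins s) ≡ k →
      D * (Y * (D * length (bins s))) ≤ Σ (λ i → count s i * itemWeight ν i) + slack
    bins-≤-items {s} inv refl = begin
      D * (Y * (D * length bs))
        ≤⟨ *-monoʳ-≤ D (*-monoʳ-≤ Y (bins-≤-groupWeight D l l≤D k bs k>0 (ok inv) blue<k (leastNeed-≤ bs))) ⟩
      D * (Y * totalSum (λ c i _ → groupWeight D l k c i) bs)
        ≤⟨ *-monoʳ-≤ D (groups-≤-items Y (groupWeight D l k) ν ν-full bs) ⟩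
      D * (ΣΣ placed + ΣΣ missing)
        ≡⟨ *-distribˡ-+ D (ΣΣ placed) (ΣΣ missing) ⟩
      D * ΣΣ placed + D * ΣΣ missing
        ≤⟨ +-mono-≤ placed-≤ (*-monoʳ-≤ D missing-≤) ⟩
      Σ weighted + Σ (λ i → ν blue i * D) + D * ΣΣ (λ c i → ν c i * maxFit c i)
        ≡⟨ +-assoc (Σ weighted) _ _ ⟩
      Σ weighted + slack
        ∎
      where
      open ≤-Reasoning
      bs = bins s
      placed missing : Color → Type → ℕ
      placed c i  = ν c i * tally items c i bs
      missing c i = ν c i * tally deficit c i bs
      weighted : Type → ℕ
      weighted i = count s i * itemWeight ν i

      k>0 : 0 < leastNeed bs
      k>0 = <-leastNeed (s≤s z≤n) bs λ u → All.lookup (ok inv) u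

      blue<k : ∀ {i b} → unmixed blue i b ∈ bs → toℕ (leaves i) < leastNeed bs
      blue<k {i} u = <-leastNeed (Fin.toℕ<n (leaves i)) bs (incompatible inv u)

      placed-≤ : D * ΣΣ placed ≤ Σ weighted + Σ (λ i → ν blue i * D)
      placed-≤ = begin
        D * ΣΣ placed
          ≡⟨ *-distribˡ-Σ D (λ i → placed blue i + placed red i) ⟩
        Σ (λ i → D * (placed blue i + placed red i))
          ≤⟨ Σ-mono (λ i → colored-≤-items ν i {tally items blue i bs} {tally items red i bs}
               (trans (cong (_+_ (tally items blue i bs)) (redItems inv i)) (blueItems inv i))
               (subst (Balanced i (count s i)) (sym (redItems inv i)) (balanced inv i))) ⟩
        Σ (λ i → weighted i + ν blue i * D)
          ≡⟨ Σ-+ weighted (λ i → ν blue i * D) ⟩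
        Σ weighted + Σ (λ i → ν blue i * D)
          ∎

      missing-≤ : ΣΣ missing ≤ ΣΣ (λ c i → ν c i * maxFit c i)
      missing-≤ = Σ-mono λ i → +-mono-≤ (*-monoʳ-≤ (ν blue i) (bounded inv blue i))
                                        (*-monoʳ-≤ (ν red i) (bounded inv red i))

  -- A potential and its growth along a run

  module _ (ω e : Type → ℕ) (A : ℕ) (ω≤ : ∀ i → i ≢ typeN → ω i ≤ e i + A * low i) where

    -- Joins the integral weights of the other types and the real levels of the Next Fit bins in one
    -- quantity. An item raises it by at most its `itemBound`; over an optimal bin these add up to
    -- an `e`-sum, bounded by the knapsack, plus `A` times a size at most 1.
    potential : State → Seq
    potential s = ⟪ Σ (λ i → count s i * ω i) ⟫ ⊞ A ⊡ approx (ℝ.sum (binsN s))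

    itemBound : Type → Item → Seq
    itemBound i x = ⟪ e i ⟫ ⊞ A ⊡ approx (size x)

    nextFit-level : ∀ {s ls ls′} → NextFit s ls ls′ → approx (ℝ.sum ls′) ≼ approx (ℝ.sum ls) ⊞ approx s
    nextFit-level {s} first = ⊞-comm-≼ (approx s) 0ˢ
    nextFit-level {s} (fits {l} {ls} _) =
      (a ⊞ b) ⊞ c     ≼⟨ ⊞-assoc-≼ a b c ⟩
      a ⊞ (b ⊞ c)     ≼⟨ ⊞-mono-≼ (≼-refl {a}) (⊞-comm-≼ b c) ⟩
      a ⊞ (c ⊞ b)     ≼⟨ ⊞-assoc-≽ a c b ⟩
      (a ⊞ c) ⊞ b     ■
      where
      a = approx l
      b = approx s
      c = approx (ℝ.sum ls)
    nextFit-level {s} (opens {l} {ls} _) = ⊞-comm-≼ (approx s) (approx l ⊞ approx (ℝ.sum ls))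

    potential-step : ∀ {x s s′} → Step x s s′ →
                     Σ[ p ∈ Typed x ] potential s′ ≼ potential s ⊞ itemBound (proj₁ p) x
    potential-step {x} (stepN {n} {ls = ls} {ls′} ty nf) = (typeN , ty) , (
      a ⊞ A ⊡ approx (ℝ.sum ls′)
        ≼⟨ ⊞-mono-≼ (≼-refl {a}) (≼-trans (⊡-monoʳ-≼ A (nextFit-level nf)) (⊡-distribˡ-≼ A _ _)) ⟩
      a ⊞ (b ⊞ c)
        ≼⟨ ⊞-assoc-≽ a b c ⟩
      (a ⊞ b) ⊞ c
        ≼⟨ ⊞-mono-≼ (≼-refl {a ⊞ b}) (≼-trans (⊞-identityʳ-≼ {c}) (≼-trans (⊞-comm-≼ c 0ˢ)
             (⊞-mono-≼ (≼-trans (≼-reflexive (λ _ → sym frac-0)) (⟪⟫-mono-≼ (z≤n {e typeN}))) (≼-refl {c})))) ⟩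
      (a ⊞ b) ⊞ itemBound typeN x
        ■)
      where
      a = ⟪ Σ (λ i → n i * ω i) ⟫
      b = A ⊡ approx (ℝ.sum ls)
      c = A ⊡ approx (size x)
    potential-step {x} (step {n} {ls = ls} {i = i} ty i≢N _ _) = (i , ty) , (
      ⟪ Σ (λ j → updateAt n i suc j * ω j) ⟫ ⊞ b
        ≼⟨ ⊞-mono-≼ (⟪⟫-mono-≼ (≤-reflexive (trans (Σ-updateAt n ω i) (+-comm (ω i) w)))) (≼-refl {b}) ⟩
      ⟪ w + ω i ⟫ ⊞ b
        ≼⟨ ⊞-mono-≼ (⟪⟫-+-≽ w (ω i)) (≼-refl {b}) ⟩
      (⟪ w ⟫ ⊞ ⟪ ω i ⟫) ⊞ b
        ≼⟨ ⊞-assoc-≼ ⟪ w ⟫ ⟪ ω i ⟫ b ⟩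
      ⟪ w ⟫ ⊞ (⟪ ω i ⟫ ⊞ b)
        ≼⟨ ⊞-mono-≼ (≼-refl {⟪ w ⟫}) (⊞-comm-≼ ⟪ ω i ⟫ b) ⟩
      ⟪ w ⟫ ⊞ (b ⊞ ⟪ ω i ⟫)
        ≼⟨ ⊞-assoc-≽ ⟪ w ⟫ b ⟪ ω i ⟫ ⟩
      (⟪ w ⟫ ⊞ b) ⊞ ⟪ ω i ⟫
        ≼⟨ ⊞-mono-≼ (≼-refl {⟪ w ⟫ ⊞ b}) ω≼ ⟩
      (⟪ w ⟫ ⊞ b) ⊞ itemBound i x
        ■)
      where
      w = Σ (λ j → n j * ω j)
      b = A ⊡ approx (ℝ.sum ls)
      ω≼ : ⟪ ω i ⟫ ≼ itemBound i x
      ω≼ = ≼-trans (⟪⟫-mono-≼ (ω≤ i i≢N)) (≼-trans (⟪⟫-+-≽ (e i) (A * low i))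
        (⊞-mono-≼ (≼-refl {⟪ e i ⟫}) (≼-trans (⊡-⟪⟫-≽ A (low i))
          (⊡-monoʳ-≼ A (≼-trans (low≼ i) (≺⇒≼ ⟨ proj₁ ty ⟩))))))

    profit : ∀ {xs} → All Typed xs → ℕ
    profit ps = sum (map e (types ps))

    potential-run : ∀ {s σ s′} → Run s σ s′ →
      Σ[ ps ∈ All Typed σ ] potential s′ ≼ potential s ⊞ (⟪ profit ps ⟫ ⊞ A ⊡ sizes σ)
    potential-run {s} [] = [] , (
      potential s                      ≼⟨ ⊞-identityʳ-≼ ⟩
      potential s ⊞ 0ˢ                 ≼⟨ ⊞-mono-≼ (≼-refl {potential s}) (
        0ˢ                             ≼⟨ ⊞-identityʳ-≼ {0ˢ} ⟩
        0ˢ ⊞ 0ˢ                        ≼⟨ ⊞-mono-≼ (≼-reflexive λ _ → sym frac-0) (≼-reflexive (⊡-0 A)) ⟩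
        ⟪ 0 ⟫ ⊞ A ⊡ 0ˢ                 ■) ⟩
      potential s ⊞ (⟪ 0 ⟫ ⊞ A ⊡ 0ˢ)   ■)
      where
      ⊡-0 : ∀ m n → 0ˢ n ≡ (m ⊡ 0ˢ) n
      ⊡-0 zero    n = refl
      ⊡-0 (suc m) n = trans (⊡-0 m n) (sym (ℚ.+-identityˡ _))
    potential-run {s} {x ∷ σ} {s″} (_∷_ {s′ = s′} st run) with potential-step st | potential-run run
    ... | p , pot | ps , pot′ = p ∷ ps , (
      potential s″
        ≼⟨ pot′ ⟩
      potential s′ ⊞ (f ⊞ b)
        ≼⟨ ⊞-mono-≼ pot (≼-refl {f ⊞ b}) ⟩
      (potential s ⊞ (c ⊞ d)) ⊞ (f ⊞ b)
        ≼⟨ ⊞-assoc-≼ (potential s) (c ⊞ d) (f ⊞ b) ⟩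
      potential s ⊞ ((c ⊞ d) ⊞ (f ⊞ b))
        ≼⟨ ⊞-mono-≼ (≼-refl {potential s}) (
             ≼-trans (interchange-≼ c d f b)
                     (⊞-mono-≼ (⟪⟫-+-≼ (e (proj₁ p)) (profit ps)) (⊡-distribˡ-≽ A (approx (size x)) (sizes σ)))) ⟩
      potential s ⊞ (⟪ profit {x ∷ σ} (p ∷ ps) ⟫ ⊞ A ⊡ sizes (x ∷ σ))
        ■)
      where
      c = ⟪ e (proj₁ p) ⟫
      d = A ⊡ approx (size x)
      f = ⟪ profit ps ⟫
      b = A ⊡ sizes σ

    -- `A` times the level of a closed bin pays its cost; the extra `⟪ Θ ⟫` pays the current bin.
    nextFit-≤-level : ∀ Θ → Θ ≤ A * (D ∸ τ) → ∀ ls → Full ls →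
                      ⟪ Θ * length ls ⟫ ≼ A ⊡ approx (ℝ.sum ls) ⊞ ⟪ Θ ⟫
    nextFit-≤-level Θ Θ≤ [] _ =
      ⟪ Θ * 0 ⟫                ≼⟨ ⟪⟫-mono-≼ (≤-reflexive (trans (*-zeroʳ Θ) (sym (*-zeroʳ A)))) ⟩
      ⟪ A * 0 ⟫                ≼⟨ ⊡-⟪⟫-≽ A 0 ⟩
      A ⊡ ⟪ 0 ⟫                ≼⟨ ⊡-monoʳ-≼ A (≼-reflexive λ _ → frac-0) ⟩
      A ⊡ 0ˢ                   ≼⟨ ⊞-identityʳ-≼ ⟩
      A ⊡ 0ˢ ⊞ 0ˢ              ≼⟨ ⊞-mono-≼ (≼-refl {A ⊡ 0ˢ}) (≼-trans (≼-reflexive λ _ → sym frac-0) (⟪⟫-mono-≼ (z≤n {Θ}))) ⟩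
      A ⊡ 0ˢ ⊞ ⟪ Θ ⟫           ■
    nextFit-≤-level Θ Θ≤ (l ∷ ls) (0≼l , full) =
      ⟪ Θ * suc (length ls) ⟫          ≼⟨ ⟪⟫-mono-≼ (≤-reflexive (trans (*-suc Θ (length ls)) (+-comm Θ _))) ⟩
      ⟪ Θ * length ls + Θ ⟫            ≼⟨ ⟪⟫-+-≽ (Θ * length ls) Θ ⟩
      ⟪ Θ * length ls ⟫ ⊞ ⟪ Θ ⟫        ≼⟨ ⊞-mono-≼ (≼-trans (tail-level ls full) grow) (≼-refl {⟪ Θ ⟫}) ⟩
      A ⊡ (approx l ⊞ approx (ℝ.sum ls)) ⊞ ⟪ Θ ⟫   ■
      where
      tail-level : ∀ ls → All (λ l → ⟪ D ∸ τ ⟫ ≼ approx l) ls → ⟪ Θ * length ls ⟫ ≼ A ⊡ approx (ℝ.sum ls)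
      tail-level [] [] = ≼-trans (⟪⟫-mono-≼ (≤-reflexive (trans (*-zeroʳ Θ) (sym (*-zeroʳ A)))))
                           (≼-trans (⊡-⟪⟫-≽ A 0) (⊡-monoʳ-≼ A (≼-reflexive λ _ → frac-0)))
      tail-level (l ∷ ls) (D-τ≼l ∷ rest) =
        ⟪ Θ * suc (length ls) ⟫                       ≼⟨ ⟪⟫-mono-≼ (≤-reflexive (*-suc Θ (length ls))) ⟩
        ⟪ Θ + Θ * length ls ⟫                         ≼⟨ ⟪⟫-+-≽ Θ (Θ * length ls) ⟩
        ⟪ Θ ⟫ ⊞ ⟪ Θ * length ls ⟫                     ≼⟨ ⊞-mono-≼ head-level (tail-level ls rest) ⟩
        A ⊡ approx l ⊞ A ⊡ approx (ℝ.sum ls)          ≼⟨ ⊡-distribˡ-≽ A (approx l) (approx (ℝ.sum ls)) ⟩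
        A ⊡ (approx l ⊞ approx (ℝ.sum ls))            ■
        where
        head-level : ⟪ Θ ⟫ ≼ A ⊡ approx l
        head-level = ≼-trans (⟪⟫-mono-≼ Θ≤) (≼-trans (⊡-⟪⟫-≽ A (D ∸ τ)) (⊡-monoʳ-≼ A D-τ≼l))

      grow : A ⊡ approx (ℝ.sum ls) ≼ A ⊡ (approx l ⊞ approx (ℝ.sum ls))
      grow = ⊡-monoʳ-≼ A (≼-trans (⊞-identityʳ-≼ {s}) (≼-trans (⊞-comm-≼ s 0ˢ)
               (⊞-mono-≼ (≼-trans (≼-reflexive λ _ → sym frac-0) 0≼l) (≼-refl {s}))))
        where s = approx (ℝ.sum ls)

    potential-initial : potential initial ≼ ⟪ 0 ⟫
    potential-initial =
      ⟪ Σ {suc M} (λ i → 0 * ω i) ⟫ ⊞ A ⊡ 0ˢ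
        ≼⟨ ⊞-mono-≼ (⟪⟫-mono-≼ (≤-reflexive (Σ-0 {suc M} λ _ → refl)))
                    (≼-trans (⊡-monoʳ-≼ A (≼-reflexive λ _ → sym frac-0)) (⊡-⟪⟫-≼ A 0)) ⟩
      ⟪ 0 ⟫ ⊞ ⟪ A * 0 ⟫    ≼⟨ ⟪⟫-+-≼ 0 (A * 0) ⟩
      ⟪ A * 0 ⟫            ≼⟨ ⟪⟫-mono-≼ (≤-reflexive (*-zeroʳ A)) ⟩
      ⟪ 0 ⟫                ■

    -- The estimate passes through ℝ, since levels and sizes are real, but both of its ends are
    -- multiples of 1/`D`, so it can be returned to ℕ.
    run-bound : ∀ Θ B C {σ s n} → Θ ≤ A * (D ∸ τ) →
      (∀ is → sum (map low is) < D → sum (map e is) ≤ B) →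
      Run initial σ s → Θ * length (bins s) ≤ Σ (λ i → count s i * ω i) + C → Packable σ n →
      Θ * (length (bins s) + length (binsN s)) ≤ n * (B + A * D) + (C + Θ)
    run-bound Θ B C {σ} {s} Θ≤ knapsack run bins≤ (packing , refl , perm , fit)
      with potential-run run
    ... | ps , pot with types-↭ e (↭-sym perm) ps
    ...   | qs , eq = ⟪⟫-cancel-≼ _ _ (
      ⟪ Θ * (b + bN) ⟫
        ≼⟨ ⟪⟫-mono-≼ (≤-reflexive (*-distribˡ-+ Θ b bN)) ⟩
      ⟪ Θ * b + Θ * bN ⟫
        ≼⟨ ⟪⟫-+-≽ (Θ * b) (Θ * bN) ⟩
      ⟪ Θ * b ⟫ ⊞ ⟪ Θ * bN ⟫
        ≼⟨ ⊞-mono-≼ (≼-trans (⟪⟫-mono-≼ bins≤) (⟪⟫-+-≽ W C))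
                    (nextFit-≤-level Θ Θ≤ (binsN s) (full (inv-run run inv-initial))) ⟩
      (⟪ W ⟫ ⊞ ⟪ C ⟫) ⊞ (A ⊡ approx (ℝ.sum (binsN s)) ⊞ ⟪ Θ ⟫)
        ≼⟨ interchange-≼ ⟪ W ⟫ ⟪ C ⟫ (A ⊡ approx (ℝ.sum (binsN s))) ⟪ Θ ⟫ ⟩
      potential s ⊞ (⟪ C ⟫ ⊞ ⟪ Θ ⟫)
        ≼⟨ ⊞-mono-≼ pot≼ (⟪⟫-+-≼ C Θ) ⟩
      ⟪ n * (B + A * D) ⟫ ⊞ ⟪ C + Θ ⟫
        ≼⟨ ⟪⟫-+-≼ (n * (B + A * D)) (C + Θ) ⟩
      ⟪ n * (B + A * D) + (C + Θ) ⟫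
        ■)
      where
      b = length (bins s)
      bN = length (binsN s)
      n = length packing
      W = Σ (λ i → count s i * ω i)
      profit≤ : profit ps ≤ n * B
      profit≤ = ≤-trans (≤-reflexive eq) (concat-bound e B knapsack packing qs fit)
      sizes≼ : A ⊡ sizes σ ≼ ⟪ A * (n * D) ⟫
      sizes≼ = ≼-trans (⊡-monoʳ-≼ A (≼-trans (sizes-↭ (↭-sym perm)) (concat-sizes packing fit))) (⊡-⟪⟫-≼ A (n * D))
      pot≼ : potential s ≼ ⟪ n * (B + A * D) ⟫
      pot≼ =
        potential s                                          ≼⟨ pot ⟩
        potential initial ⊞ (⟪ profit ps ⟫ ⊞ A ⊡ sizes σ)    ≼⟨ ⊞-mono-≼ potential-initial (⊞-mono-≼ (⟪⟫-mono-≼ profit≤) sizes≼) ⟩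
        ⟪ 0 ⟫ ⊞ (⟪ n * B ⟫ ⊞ ⟪ A * (n * D) ⟫)                ≼⟨ ⊞-mono-≼ (≼-refl {⟪ 0 ⟫}) (⟪⟫-+-≼ (n * B) (A * (n * D))) ⟩
        ⟪ 0 ⟫ ⊞ ⟪ n * B + A * (n * D) ⟫                      ≼⟨ ⟪⟫-+-≼ 0 _ ⟩
        ⟪ n * B + A * (n * D) ⟫                              ≼⟨ ⟪⟫-mono-≼ (≤-reflexive (collect n B A D)) ⟩
        ⟪ n * (B + A * D) ⟫                                  ■
        where
        collect : ∀ n B A D → n * B + A * (n * D) ≡ n * (B + A * D)
        collect = solve-∀

-- Algorithms given by integer tables

-- Junk value: quot m 0 = m.
quot : ℕ → ℕ → ℕ
quot m n = m ℕ./ suc (pred n)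

quot-lower : ∀ m {n} → 0 < n → quot m n * n ≤ m
quot-lower m {suc n} _ = m/n*n≤m m (suc n)

quot-upper : ∀ m {n} → 0 < n → m < suc (quot m n) * n
quot-upper m {suc n} _ = begin-strict
  m                                    ≡⟨ m≡m%n+[m/n]*n m (suc n) ⟩
  m % suc n + m ℕ./ suc n * suc n        <⟨ +-monoˡ-< (m ℕ./ suc n * suc n) (m%n<n m (suc n)) ⟩
  suc n + m ℕ./ suc n * suc n            ∎
  where open ≤-Reasoning

-- For increasing spaces, the number of the largest one within `r`, or 0 if there is none; so
-- `leavesᴺ` is as large as the rules allow.
leading : ∀ {n} → Vec ℕ n → ℕ → Fin (suc n)
leading []       r = zero
leading (s ∷ ss) r = if s ≤ᵇ r then suc (leading ss r) else zero

-- Positions are counted from 1; 0 means that there is no such entry.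
firstAbove : ∀ {n} → Vec ℕ n → ℕ → Fin (suc n)
firstAbove []       r = zero
firstAbove (s ∷ ss) r = if r ≤ᵇ s then suc zero else next (firstAbove ss r)
  where
  next : ∀ {n} → Fin (suc n) → Fin (suc (suc n))
  next zero    = zero
  next (suc i) = suc (suc i)

lowerEndℕ : ∀ {M} → (Fin (suc M) → ℕ) → Fin (suc M) → ℕ
lowerEndℕ {zero}  f zero    = 0
lowerEndℕ {suc M} f zero    = f (suc zero)
lowerEndℕ {suc M} f (suc j) = lowerEndℕ (f ∘ suc) j

every : ∀ {n} → (Fin n → Bool) → Bool
every {zero}  f = true
every {suc n} f = f zero ∧ every (f ∘ suc)

every-sound : ∀ {n} (f : Fin n → Bool) → every f ≡ true → ∀ i → T (f i)
every-sound f all i = lookup-every f (subst T (sym all) _) i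
  where
  lookup-every : ∀ {n} (f : Fin n → Bool) → T (every f) → ∀ i → T (f i)
  lookup-every f t zero    = ∧ˡ {f zero} t
  lookup-every f t (suc i) = lookup-every (f ∘ suc) (∧ʳ {f zero} t) i

module Tables (D : ℕ) .{{_ : NonZero D}} {M K : ℕ}
              (thresholds shares : Vec ℕ (suc M)) (spaces : Vec ℕ K) where

  tᴺ αᴺ bluefitᴺ redfitᴺ : Fin (suc M) → ℕ
  leavesᴺ needsᴺ : Fin (suc M) → Fin (suc K)
  sᴺ : Fin K → ℕ

  tᴺ         = lookup thresholds
  αᴺ         = lookup shares
  sᴺ         = lookup spaces
  bluefitᴺ j = quot D (tᴺ j)
  leavesᴺ j  = leading spaces (D ∸ bluefitᴺ j * tᴺ j)
  needsᴺ j   = if αᴺ j ≡ᵇ 0 then zero else firstAbove spaces (tᴺ j)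
  redfitᴺ j  = fit (needsᴺ j)
    where
    fit : Fin (suc K) → ℕ
    -- A positive default for types without red items, so that `ν` may divide by `maxFit` for either
    -- color.
    fit zero    = 1
    fit (suc k) = quot (sᴺ k) (tᴺ j)

  record Valid : Set where
    field
      t-first       : tᴺ zero ≡ D
      t-decreasing  : ∀ i j → i Fin.≤ j → tᴺ j ≤ tᴺ i
      t-positive    : ∀ i → 0 < tᴺ i
      s-increasing  : ∀ k l → k Fin.≤ l → sᴺ k ≤ sᴺ l
      s-positive    : ∀ k → 0 < sᴺ k
      s-<D          : ∀ k → sᴺ k < D
      α-≤D          : ∀ j → αᴺ j ≤ D
      bluefit-≥1    : ∀ j → 1 ≤ bluefitᴺ j
      redfit-≥1     : ∀ j → 1 ≤ redfitᴺ j
      needs-zero    : ∀ j → needsᴺ j ≡ zero → αᴺ j ≡ 0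
      needs-nonzero : ∀ j → αᴺ j ≡ 0 → needsᴺ j ≡ zero
      leaves-fits   : ∀ j k → leavesᴺ j ≡ suc k → sᴺ k + bluefitᴺ j * tᴺ j ≤ D

  module Algorithm (V : Valid) where
    open Valid V
    open Scaled D

    ≼-0 : ∀ {x} → ⟪ 0 ⟫ ≼ x → 0ˢ ≼ x
    ≼-0 = ≼-trans (≼-reflexive λ _ → sym frac-0)

    ≼-1 : ∀ {x} → x ≼ ⟪ D ⟫ → x ≼ approx 1ℝ
    ≼-1 le = ≼-trans le (≼-reflexive λ _ → frac-D)

    redspace-fits : ∀ s b {t} → s + b * t ≤ D → ⟦ s ⟧ ℝ.≤ 1ℝ ℝ.- b ℝ.· ⟦ t ⟧
    redspace-fits s b {t} le = ≼⇒≤ (⊞-cancelʳ-≼ ⟪ b * t ⟫ {⟪ s ⟫} {approx (1ℝ ℝ.- b ℝ.· ⟦ t ⟧)} (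
      ⟪ s ⟫ ⊞ ⟪ b * t ⟫                             ≼⟨ ⟪⟫-+-≼ s (b * t) ⟩
      ⟪ s + b * t ⟫                                 ≼⟨ ≼-1 (⟪⟫-mono-≼ le) ⟩
      approx 1ℝ                                     ≼⟨ ≼-reflexive undo ⟩
      approx (1ℝ ℝ.- b ℝ.· ⟦ t ⟧) ⊞ ⟪ b * t ⟫       ■))
      where
      undo : ∀ n → 1ℚ ≡ (1ℚ ℚ.- approx (b ℝ.· ⟦ t ⟧) n) ℚ.+ frac (b * t)
      undo n rewrite ·-⟦⟧ b t n = sym (//-rightDividesˡ (frac (b * t)) 1ℚ)

    algorithm : SuperHarmonic
    algorithm = record
      { M = M ; K = K
      ; t        = λ j → ⟦ tᴺ j ⟧
      ; redspace = λ k → ⟦ sᴺ k ⟧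
      ; red      = λ j → ⟦ αᴺ j ⟧
      ; leaves   = leavesᴺ
      ; needs    = needsᴺ
      ; bluefit  = bluefitᴺ
      ; redfit   = redfitᴺ
      ; t-first  = subst (λ a → ⟦ a ⟧ ℝ.≃ 1ℝ) (sym t-first)
                     (≼⇒≤ (≼-reflexive λ _ → frac-D) , ≼⇒≤ (≼-reflexive λ _ → sym frac-D))
      ; t-decreasing = λ i j i≤j → ≼⇒≤ (⟪⟫-mono-≼ (t-decreasing i j i≤j))
      ; t-positive   = ≺⇒< (≼-≺-trans (≼-reflexive λ _ → sym frac-0) (⟪⟫-mono-≺ (t-positive (fromℕ M))))
      ; redspace-increasing = λ k l k≤l → ≼⇒≤ (⟪⟫-mono-≼ (s-increasing k l k≤l))
      ; redspace-positive   = λ k → ≺⇒< (≼-≺-trans (≼-reflexive λ _ → sym frac-0) (⟪⟫-mono-≺ (s-positive k)))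
      ; redspace-<1         = λ k → ≺⇒< (≺-≼-trans (⟪⟫-mono-≺ (s-<D k)) (≼-reflexive λ _ → frac-D))
      ; red-nonNegative = λ j → ≼⇒≤ (≼-0 (⟪⟫-mono-≼ z≤n))
      ; red-≤1          = λ j → ≼⇒≤ (≼-1 (⟪⟫-mono-≼ (α-≤D j)))
      ; bluefit-floor = λ j → floor-D j (⟦⟧-floor D (tᴺ j) (bluefitᴺ j) (quot-lower D (t-positive j)) (quot-upper D (t-positive j)))
      ; needs-zero = λ j → mk⇔
          (λ eq → subst (λ a → ⟦ a ⟧ ℝ.≃ 0ℝ) (sym (needs-zero j eq))
                    (≼⇒≤ (≼-reflexive λ _ → frac-0) , ≼⇒≤ (≼-reflexive λ _ → sym frac-0)))
          (λ (α≤0 , _) → needs-nonzero j (n≤0⇒n≡0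
            (⟪⟫-cancel-≼ (αᴺ j) 0 (≼-trans ⟨ α≤0 ⟩ (≼-reflexive λ _ → sym frac-0)))))
      ; redfit-floor = λ j k _ eq → redfit-floor j k eq
      ; redfit-≥1    = λ j _ → redfit-≥1 j
      ; leaves-fits  = λ j k eq → redspace-fits (sᴺ k) (bluefitᴺ j) (leaves-fits j k eq)
      }
      where
      floor-D : ∀ j → ⌊ ⟦ D ⟧ ÷ ⟦ tᴺ j ⟧ ⌋≡ bluefitᴺ j → ⌊ 1ℝ ÷ ⟦ tᴺ j ⟧ ⌋≡ bluefitᴺ j
      floor-D j (lo , hi) =
        ≼⇒≤ (≼-1 ⟨ lo ⟩) , ≺⇒< (≼-≺-trans (≼-reflexive λ _ → sym frac-D) ⟨ hi ⟩)

      redfit-floor : ∀ j k → needsᴺ j ≡ suc k → ⌊ ⟦ sᴺ k ⟧ ÷ ⟦ tᴺ j ⟧ ⌋≡ redfitᴺ j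
      redfit-floor j k eq rewrite eq =
        ⟦⟧-floor (sᴺ k) (tᴺ j) (quot (sᴺ k) (tᴺ j)) (quot-lower (sᴺ k) (t-positive j)) (quot-upper (sᴺ k) (t-positive j))

    low-spec : ∀ {M} (f : Fin (suc M) → ℕ) i → ⟪ lowerEndℕ f i ⟫ ≼ approx (lowerEnd (λ j → ⟦ f j ⟧) i)
    low-spec {zero}  f zero    = ≼-reflexive λ _ → frac-0
    low-spec {suc M} f zero    = ≼-refl
    low-spec {suc M} f (suc i) = low-spec (f ∘ suc) i

    integral : Integral algorithm D
    integral = record
      { α = αᴺ ; low = lowerEndℕ tᴺ ; τ = tᴺ (fromℕ M)
      ; red≡ = λ _ → refl ; α≤D = α-≤D
      ; needs>0 = needs>0
      ; low≼ = low-spec tᴺ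
      ; t≼τ = ≼-refl
      ; τ≤D = subst (tᴺ (fromℕ M) ≤_) t-first (t-decreasing zero (fromℕ M) z≤n) }
      where
      needs>0 : ∀ i → 0 < αᴺ i → 0 < toℕ (needsᴺ i)
      needs>0 i 0<α with needsᴺ i in eq
      ... | zero  = contradiction (needs-zero i eq) (m<n⇒n≢0 0<α)
      ... | suc _ = s≤s z≤n

    open Execution algorithm hiding (cost)
    open Counting algorithm using (leastNeed; leastNeed-≤sucK; <-leastNeed)
    open Weights algorithm
    open Analysis algorithm D integral

    fit-positive : ∀ c i → 0 < maxFit c i
    fit-positive blue = bluefit-≥1
    fit-positive red  = redfit-≥1

    -- Item weights from mixing coefficients, and their verification

    module Certificate (Y unit : ℕ) .{{_ : NonZero unit}} (mixing : Vec ℕ (suc K)) where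
      open Knapsack unit

      -- The group weight, scaled by `Y` to keep the rounding loss small, is split evenly over the
      -- items of a full group and rounded up. The index `κ` stands for the least need `κ + 1`.
      ν : Fin (suc K) → Color → Type → ℕ
      ν κ c i = suc (quot (Y * groupWeight D (lookup mixing κ) (suc (toℕ κ)) c i) (maxFit c i))

      ω : Fin (suc K) → Type → ℕ
      ω κ = itemWeight (ν κ)

      ν-full : ∀ κ c i → Y * groupWeight D (lookup mixing κ) (suc (toℕ κ)) c i ≤ maxFit c i * ν κ c i
      ν-full κ c i = ≤-trans (<⇒≤ (quot-upper _ (fit-positive c i))) (≤-reflexive (*-comm (ν κ c i) (maxFit c i)))

      -- Weights are scaled so that a bin costs Θ; A is the weight of type N
      -- items of total size 1.
      Θ A : ℕ
      Θ = D * (Y * D)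
      A = suc (quot Θ (D ∸ tᴺ (fromℕ M)))

      -- The weight beyond the charge of `A` per unit for the lower end of the type. Cutting off at
      -- 0 can only enlarge it. Type N items are charged by their true size alone.
      excess : Fin (suc K) → Type → ℕ
      excess κ i = if does (i Fin.≟ typeN) then 0 else ω κ i ∸ A * lowerEndℕ tᴺ i

      ω≤ : ∀ κ i → i ≢ typeN → ω κ i ≤ excess κ i + A * lowerEndℕ tᴺ i
      ω≤ κ i i≢N with i Fin.≟ typeN
      ... | yes i≡N = contradiction i≡N i≢N
      ... | no  _   = ≤-trans (m≤n+m∸n (ω κ i) (A * lowerEndℕ tᴺ i)) (≤-reflexive (+-comm (A * lowerEndℕ tᴺ i) _))

      toObject : Fin (suc K) → Type → Object
      toObject κ i = withDensity (lowerEndℕ tᴺ i) (excess κ i)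

      objects : Fin (suc K) → List Object
      objects κ = sort (map (toObject κ) (allFin (suc M)))

      headDensity : List Object → ℕ
      headDensity []      = 0
      headDensity (x ∷ _) = density x

      certified : (depth B : ℕ) → Fin (suc K) → Bool
      certified depth B κ = dense (headDensity (objects κ)) (objects κ) ∧ bounded depth (objects κ) (pred D) B

      weight-toObject : ∀ κ i → weight (toObject κ i) ≡ lowerEndℕ tᴺ i
      weight-toObject κ i with excess κ i
      ... | zero  = refl
      ... | suc _ = refl

      profit-toObject : ∀ κ i → Object.profit (toObject κ i) ≡ excess κ i
      profit-toObject κ i with excess κ i
      ... | zero  = refl
      ... | suc _ = refl

      knapsack : ∀ depth B κ → T (certified depth B κ) →
                 ∀ is → sum (map (lowerEndℕ tᴺ) is) < D → sum (map (excess κ) is) ≤ B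
      knapsack depth B κ ok is light = subst (_≤ B) (sums Object.profit (excess κ) (profit-toObject κ) is)
        (bounded-sound depth {d} {objects κ} {pred D}
          (∧ˡ {dense d (objects κ)} ok) (∧ʳ {dense d (objects κ)} ok) (map (toObject κ) is) (members is)
          (≤-trans (≤-reflexive (sums weight (lowerEndℕ tᴺ) (weight-toObject κ) is)) (<⇒≤pred light)))
        where
        d = headDensity (objects κ)
        sums : ∀ (f : Object → ℕ) (g : Type → ℕ) → (∀ i → f (toObject κ i) ≡ g i) → ∀ is →
               sum (map f (map (toObject κ) is)) ≡ sum (map g is)
        sums f g eq []       = refl
        sums f g eq (i ∷ is) = cong₂ _+_ (eq i) (sums f g eq is)
        members : ∀ is → All (_∈ objects κ) (map (toObject κ) is)
        members []       = []
        members (i ∷ is) = sort-∈ (map (toObject κ) (allFin (suc M))) (∈-map⁺ (toObject κ) (∈-allFin i)) ∷ members is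

      module _ (depth B : ℕ) (mixing≤D : ∀ κ → lookup mixing κ ≤ D)
               (τ<D : tᴺ (fromℕ M) < D)
               (certificate : every (certified depth B) ≡ true) where

        slacks : Fin (suc K) → ℕ
        slacks κ = slack Y (lookup mixing κ) (mixing≤D κ) (suc (toℕ κ)) (ν κ) (ν-full κ)

        -- `κ` is known only from the final packing, and its weights are then applied to the whole
        -- run. Summing all slacks makes the additive constant independent of `κ`, hence of the
        -- input.
        cost-bound : ∀ {σ k n} → cost algorithm σ k → Packable σ n →
                     Θ * k ≤ n * (B + A * D) + (Σ slacks + Θ)
        cost-bound {n = n} (s , run , refl) packable = ≤-trans
          (run-bound (ω κ) (excess κ) A (ω≤ κ) Θ B (slacks κ) Θ≤
            (knapsack depth B κ (every-sound (certified depth B) certificate κ)) run bins≤ packable)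
          (+-monoʳ-≤ (n * (B + A * D)) (+-monoˡ-≤ Θ (f≤Σ slacks κ)))
          where
          inv = inv-run run inv-initial
          bs = bins s
          k>0 : 0 < leastNeed bs
          k>0 = <-leastNeed (s≤s z≤n) bs λ u → All.lookup (Invariant.ok inv) u
          k-1<sucK : pred (leastNeed bs) < suc K
          k-1<sucK = ≤-trans (≤-reflexive (suc-pred (leastNeed bs) {{>-nonZero k>0}})) (leastNeed-≤sucK bs)
          κ : Fin (suc K)
          κ = Fin.fromℕ< k-1<sucK
          k≡ : leastNeed bs ≡ suc (toℕ κ)
          k≡ = trans (sym (suc-pred (leastNeed bs) {{>-nonZero k>0}})) (cong suc (sym (Fin.toℕ-fromℕ< k-1<sucK)))
          Θ≤ : Θ ≤ A * (D ∸ tᴺ (fromℕ M))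
          Θ≤ = <⇒≤ (quot-upper Θ (m<n⇒0<n∸m τ<D))
          bins≤ : Θ * length bs ≤ Σ (λ i → count s i * ω κ i) + slacks κ
          bins≤ = ≤-trans (≤-reflexive (assoc D Y (length bs)))
            (bins-≤-items Y (lookup mixing κ) (mixing≤D κ) (suc (toℕ κ)) (ν κ) (ν-full κ) inv k≡)
            where
            assoc : ∀ D Y b → D * (Y * D) * b ≡ D * (Y * (D * b))
            assoc = solve-∀

-- From a bound with an additive constant to the asymptotic ratio

ratio-bound : ∀ (𝒜 : Cost) a b .{{_ : NonZero b}} Θ ρ C → 0 < Θ → ρ * b ≤ a * Θ →
              (∀ {σ k n} → 𝒜 σ k → Packable σ n → Θ * k ≤ n * ρ + C) →
              AsymptoticRatio≤ 𝒜 (+ a / b)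
ratio-bound 𝒜 a b Θ ρ C 0<Θ ρ≤ bound q c<q = threshold q num<
  where
  num< : + a ℚᵘ./ b ℚᵘ.< ℚ.toℚᵘ q
  num< = ℚᵘ.<-respˡ-≃ (toℚᵘ-/ a b) (ℚ.toℚᵘ-mono-< c<q)

  cross : ∀ b .{{_ : NonZero b}} p d → + a ℚᵘ./ b ℚᵘ.< ℚᵘ.mkℚᵘ p d → + a ℤ.* + suc d ℤ.< p ℤ.* + b
  cross (suc b) p d (ℚᵘ.*<* lt) = lt

  threshold : ∀ q → + a ℚᵘ./ b ℚᵘ.< ℚ.toℚᵘ q →
              ∃[ m ] (∀ n → m ≤ n → ∀ r → Ratio 𝒜 n r → r ℚ.≤ q)
  threshold (mkℚ -[1+ p ] d _) lt = contradiction (cross b -[1+ p ] d lt) (ℤ.≤⇒≯ (begin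
    -[1+ p ] ℤ.* + b           ≤⟨ ℤ.*-monoʳ-≤-nonNeg (+ b) (ℤ.-≤+ {p} {0}) ⟩
    + 0 ℤ.* + b                ≡⟨ ℤ.*-zeroˡ (+ b) ⟩
    + 0                        ≤⟨ ℤ.+≤+ z≤n ⟩
    + (a * suc d)              ≡⟨ ℤ.pos-* a (suc d) ⟩
    + a ℤ.* + suc d            ∎))
    where open ℤ.≤-Reasoning
  -- Here `q` is `p / suc d` and exceeds `a / b`, so the integers `p * b` and `a * suc d` differ by
  -- at least 1. This leaves a margin of `Θ * n` below, which absorbs the constant from this
  -- threshold on.
  threshold q@(mkℚ (+ p) d _) lt = b * suc d * C , below
    where
    ad<pb : a * suc d < p * b
    ad<pb = ℤ.drop‿+<+ ad<pb′
      where
      ad<pb′ : + (a * suc d) ℤ.< + (p * b)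
      ad<pb′ = subst₂ ℤ._<_ (sym (ℤ.pos-* a (suc d))) (sym (ℤ.pos-* p b)) (cross b (+ p) d lt)

    below : ∀ n → b * suc d * C ≤ n → ∀ r → Ratio 𝒜 n r → r ℚ.≤ q
    below n m≤n _ (ratio {k = k} (packable , _) run) = ℚ.toℚᵘ-cancel-≤
      (ℚᵘ.≤-respˡ-≃ (ℚᵘ.≃-sym (toℚᵘ-/ k n)) (uncross n kd≤pn))
      where
      uncross : ∀ n .{{_ : NonZero n}} → k * suc d ≤ p * n → + k ℚᵘ./ n ℚᵘ.≤ ℚᵘ.mkℚᵘ (+ p) d
      uncross (suc n) le = ℚᵘ.*≤* (subst₂ ℤ._≤_ (ℤ.pos-* k (suc d)) (ℤ.pos-* p (suc n)) (ℤ.+≤+ le))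

      kd≤pn : k * suc d ≤ p * n
      kd≤pn = *-cancelˡ-≤ (Θ * b) {{m*n≢0 Θ b {{>-nonZero 0<Θ}}}} (begin
        Θ * b * (k * suc d)                       ≡⟨ regroup Θ b k (suc d) ⟩
        Θ * k * (b * suc d)                       ≤⟨ *-monoˡ-≤ (b * suc d) (bound run packable) ⟩
        (n * ρ + C) * (b * suc d)                 ≡⟨ expand n ρ C b (suc d) ⟩
        ρ * b * (n * suc d) + b * suc d * C       ≤⟨ +-mono-≤ (*-monoˡ-≤ (n * suc d) ρ≤) m≤n ⟩
        a * Θ * (n * suc d) + n                   ≤⟨ +-monoʳ-≤ (a * Θ * (n * suc d)) (m≤n*m n Θ {{>-nonZero 0<Θ}}) ⟩
        a * Θ * (n * suc d) + Θ * n               ≡⟨ collect a Θ n (suc d) ⟩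
        Θ * n * suc (a * suc d)                   ≤⟨ *-monoʳ-≤ (Θ * n) ad<pb ⟩
        Θ * n * (p * b)                           ≡⟨ regroup′ Θ n p b ⟩
        Θ * b * (p * n)                           ∎)
        where
        open ≤-Reasoning
        regroup : ∀ Θ b k d → Θ * b * (k * d) ≡ Θ * k * (b * d)
        regroup = solve-∀
        regroup′ : ∀ Θ n p b → Θ * n * (p * b) ≡ Θ * b * (p * n)
        regroup′ = solve-∀
        expand : ∀ n ρ C b d → (n * ρ + C) * (b * d) ≡ ρ * b * (n * d) + b * d * C
        expand = solve-∀
        collect : ∀ a Θ n d → a * Θ * (n * d) + Θ * n ≡ Θ * n * (1 + a * d)
        collect = solve-∀

-- The algorithm

-- Sizes, shares and mixing coefficients are in units of 1/10080.  The
-- tables were found numerically, by linear programming over shares and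
-- mixing for fixed thresholds and spaces, and local search over the latter.
-- The entry κ of mixing belongs to the least need κ + 1.

thresholds : Vec ℕ 56
thresholds =
  10080 ∷ 6684 ∷ 6614 ∷ 6508 ∷ 6262 ∷ 5872 ∷ 5040 ∷ 4208 ∷ 3818 ∷ 3572 ∷ 3504 ∷ 3466 ∷ 3396 ∷ 3360 ∷
  2959 ∷ 2520 ∷ 2016 ∷ 1680 ∷ 1512 ∷ 1440 ∷ 1260 ∷ 1120 ∷ 1008 ∷ 916 ∷ 840 ∷ 775 ∷ 720 ∷ 672 ∷
  630 ∷ 592 ∷ 560 ∷ 530 ∷ 504 ∷ 480 ∷ 458 ∷ 438 ∷ 420 ∷ 403 ∷ 387 ∷ 373 ∷ 360 ∷ 347 ∷
  336 ∷ 325 ∷ 315 ∷ 305 ∷ 296 ∷ 288 ∷ 280 ∷ 272 ∷ 265 ∷ 258 ∷ 252 ∷ 245 ∷ 240 ∷ 234 ∷ []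

shares : Vec ℕ 56
shares =
  0 ∷ 0 ∷ 0 ∷ 0 ∷ 0 ∷ 0 ∷ 0 ∷ 760 ∷ 1270 ∷ 1410 ∷ 1500 ∷ 1630 ∷ 1705 ∷ 0 ∷
  827 ∷ 765 ∷ 300 ∷ 660 ∷ 1100 ∷ 900 ∷ 800 ∷ 660 ∷ 600 ∷ 500 ∷ 500 ∷ 400 ∷ 300 ∷ 300 ∷
  300 ∷ 200 ∷ 180 ∷ 200 ∷ 240 ∷ 200 ∷ 200 ∷ 200 ∷ 200 ∷ 200 ∷ 200 ∷ 100 ∷ 100 ∷ 100 ∷
  100 ∷ 100 ∷ 100 ∷ 100 ∷ 100 ∷ 100 ∷ 100 ∷ 100 ∷ 100 ∷ 100 ∷ 100 ∷ 100 ∷ 100 ∷ 0 ∷ []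

-- All but the first are thresholds whose complements to 10080 are thresholds too: a red item of
-- such a type fits the space, and a blue item up to the complement leaves it. The first space is
-- left by two blue items with threshold 3396, 3466 or 3504.
spaces : Vec ℕ 6
spaces =
  3024 ∷ 3396 ∷ 3466 ∷ 3572 ∷ 3818 ∷ 4208 ∷ []

-- The last entry belongs to packings without unmixed red bins: every bin then has a blue group, and
-- with 0 only blue groups are counted.
mixing : Vec ℕ 7
mixing =
  2100 ∷ 1900 ∷ 1800 ∷ 1600 ∷ 1400 ∷ 800 ∷ 0 ∷ []

open Tables 10080 thresholds shares spaces

valid : Valid
valid = record
  { t-first       = refl
  ; t-decreasing  = toWitness {a? = Fin.all? λ i → Fin.all? λ j → (i Fin.≤? j) →-dec (tᴺ j ≤? tᴺ i)} _
  ; t-positive    = toWitness {a? = Fin.all? λ i → 0 <? tᴺ i} _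
  ; s-increasing  = toWitness {a? = Fin.all? λ k → Fin.all? λ l → (k Fin.≤? l) →-dec (sᴺ k ≤? sᴺ l)} _
  ; s-positive    = toWitness {a? = Fin.all? λ k → 0 <? sᴺ k} _
  ; s-<D          = toWitness {a? = Fin.all? λ k → sᴺ k <? 10080} _
  ; α-≤D          = toWitness {a? = Fin.all? λ j → αᴺ j ≤? 10080} _
  ; bluefit-≥1    = toWitness {a? = Fin.all? λ j → 1 ≤? bluefitᴺ j} _
  ; redfit-≥1     = toWitness {a? = Fin.all? λ j → 1 ≤? redfitᴺ j} _
  ; needs-zero    = toWitness {a? = Fin.all? λ j → (needsᴺ j Fin.≟ zero) →-dec (αᴺ j ≟ 0)} _
  ; needs-nonzero = toWitness {a? = Fin.all? λ j → (αᴺ j ≟ 0) →-dec (needsᴺ j Fin.≟ zero)} _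
  ; leaves-fits   = toWitness {a? = Fin.all? λ j → Fin.all? λ k →
                      (leavesᴺ j Fin.≟ suc k) →-dec (sᴺ k + bluefitᴺ j * tᴺ j ≤? 10080)} _
  }

open Algorithm valid
-- Resolutions: 1000 for the rounding of item weights, 1000000 for that of the densities which prune
-- the search.
open Certificate 1000 1000000 mixing

-- 1.5884 Θ - A D
budget : ℕ
budget = 57370420800

mixing≤D : ∀ κ → lookup mixing κ ≤ 10080
mixing≤D = toWitness {a? = Fin.all? λ κ → lookup mixing κ ≤? 10080} _

τ<D : tᴺ (fromℕ 55) < 10080
τ<D = toWitness {a? = tᴺ (fromℕ 55) <? 10080} _

certificate : every (certified 100 budget) ≡ true
-- The type checker runs the seven searches, one per least need; none of them exhausts the depth
-- 100.
certificate = refl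

mainTheorem2 : Σ[ A ∈ SuperHarmonic ] AsymptoticRatio≤ (cost A) (+ 15884 / 10000)
mainTheorem2 = algorithm , ratio-bound (cost algorithm) 15884 10000
  Θ (budget + A * 10080) (Σ (slacks 100 budget mixing≤D τ<D certificate) + Θ)
  (toWitness {a? = 0 <? Θ} _)
  (toWitness {a? = (budget + A * 10080) * 10000 ≤? 15884 * Θ} _)
  (cost-bound 100 budget mixing≤D τ<D certificate)
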